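{- For integers $n,k,r$, the number of contracted plabic trees of type $(k,n)$ with momentum amplituhedron dimension $r$ equals $[x^ny^kq^r]\mathcal P_{\mathrm{tree}}(x,y,q)$, where $$\mathcal P_{\mathrm{tree}}(x,y,q)=x\left(1+y+yq\,C^{\langle-1\rangle}(x,y,q)\right),\qquad C(x,y,q)=\frac{x(1-q^2x^2y)}{(1+xq)(1+xyq)},$$ with compositional inverse taken with respect to $x$. The number of contracted plabic forests of type $(k,n)$ with momentum amplituhedron dimension $r$ equals $[x^ny^kq^r]\mathcal P_{\mathrm{forest}}(x,y,q)$, where $$x\,\mathcal P_{\mathrm{forest}}(x,y,q)=\left(\frac{x}{1+\mathcal P_{\mathrm{tree}}(x,y,q)}\right)^{\langle-1\rangle}$$ (compositional inverse in $x$); equivalently, $[x^n]\mathcal P_{\mathrm{forest}}(x,y,q)=\frac{1}{n+1}[x^n]\left(1+\mathcal P_{\mathrm{tree}}(x,y,q)\right)^{n+1}$.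
   Context: A Grassmannian graph is a finite planar graph embedded in a closed disk with $n$ boundary vertices $b_1,\dots,b_n$ of degree $1$ on the boundary circle, labelled clockwise; all other vertices (internal vertices) lie in the interior, each is connected by a path to the boundary, and no vertex has degree $2$. Each internal vertex $v$ carries an integer helicity $h(v)$: if $v$ is a boundary leaf (an internal vertex of degree $1$ adjacent to a boundary vertex) then $h(v)\in\{0,1\}$; otherwise $1\le h(v)\le\deg(v)-1$. An internal vertex is white if $h(v)=1$, black if $h(v)=\deg(v)-1$, generic otherwise. The helicity of the graph $G$ is $h(G)=\sum_{v\text{ internal}}\left(h(v)-\frac{\deg v}{2}\right)+\frac n2$, and $G$ has type $(k,n)$ if $h(G)=k$. A plabic graph is a Grassmannian graph with no generic vertices. A plabic forest (tree) is an acyclic (connected acyclic) plabic graph; it is contracted if no two adjacent internal vertices are both white and no two adjacent internal vertices are both black. Graphs are counted up to isotopy of the disk fixing the labelled boundary vertices (the empty forest with $n=0$ is allowed). Momentum amplituhedron dimension: for an internal vertex $v$ let $m(v)=2\deg(v)-4$ if $v$ is generic and $m(v)=\deg(v)-1$ otherwise; for a tree $T$ with $n$ boundary vertices, $\dim_{\mathcal M}(T)=n-1$ if $n\le2$ and $1+\sum_{v\text{ internal}}(m(v)-1)$ otherwise; for a forest, $\dim_{\mathcal M}$ is the sum over its connected components (each a tree on its own boundary vertices). Compositional inverse $f^{\langle -1\rangle}$ of a series $f\in x\,\mathbb Q(y,q)[[x]]$ with nonzero coefficient of $x$ is the series with $f(f^{\langle-1\rangle}(x))=f^{\langle-1\rangle}(f(x))=x$;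 $[x^ny^kq^r]$ denotes coefficient extraction. -}

module Defs where

open import Data.Nat as ℕ using (ℕ; zero; suc; _∸_; _≡ᵇ_; _≤ᵇ_)
open import Data.Integer as ℤ using (ℤ; +_; -[1+_]; _+_; _-_; _*_; -_)
open import Data.Bool using (Bool; true; false; _∧_; _∨_; not; if_then_else_)
open import Data.List using (List; []; _∷_; length; _++_)
open import Data.Unit using (⊤)
open import Data.Product using (Σ; _×_; _,_; proj₁; proj₂)
open import Relation.Binary.PropositionalEquality using (_≡_)

-- Combinatorial encoding of planar trees in a disk (up to isotopy).
--
-- A tree containing the boundary vertex b₁ is encoded by the branch
-- hanging off b₁ (b₁ has degree 1).  A branch is either a boundary
-- vertex, or an internal vertex carrying its helicity h and the list of
-- its further neighbours (branches) in clockwise order, starting right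
-- after the edge towards the parent.  The boundary vertices met in this
-- depth-first clockwise traversal are b₂, b₃, … (clockwise labelling).
-- The parameter A is a decoration on non-root boundary vertices (used
-- for forests: the sub-forest in the boundary gap following the vertex).

data Br (A : Set) : Set where
  bdry : A → Br A
  node : ℕ → List (Br A) → Br A

Tree : Set
Tree = Br ⊤

module _ {A : Set} where
  mutual
    nb : Br A → ℕ
    nb (bdry _)    = 1
    nb (node _ cs) = nbL cs

    nbL : List (Br A) → ℕ
    nbL []       = 0
    nbL (c ∷ cs) = nb c ℕ.+ nbL cs

  mutual
    verts : Br A → List (ℕ × ℕ)
    verts (bdry _)    = []
    verts (node h cs) = (h , suc (length cs)) ∷ vertsL cs

    vertsL : List (Br A) → List (ℕ × ℕ)
    vertsL []       = []
    vertsL (c ∷ cs) = verts c ++ vertsL cs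

treeN : Tree → ℕ
treeN t = suc (nb t)

okInner : ℕ → ℕ → Bool
okInner h d = not (d ≡ᵇ 2) ∧ (1 ≤ᵇ h) ∧ (h ≤ᵇ (d ∸ 1))

module _ {A : Set} where
  mutual
    grassInner : Br A → Bool
    grassInner (bdry _)    = true
    grassInner (node h cs) = okInner h (suc (length cs)) ∧ grassL cs

    grassL : List (Br A) → Bool
    grassL []       = true
    grassL (c ∷ cs) = grassInner c ∧ grassL cs

  -- the neighbour of b₁: a degree-1 internal vertex there is a boundary
  -- leaf, with h ∈ {0,1}
  grassRoot : Br A → Bool
  grassRoot (bdry _)          = true
  grassRoot (node h [])       = h ≤ᵇ 1
  grassRoot (node h (c ∷ cs)) = grassInner (node h (c ∷ cs))

isWhite : ℕ × ℕ → Bool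
isWhite (h , d) = h ≡ᵇ 1

isBlack : ℕ × ℕ → Bool
isBlack (h , d) = h ≡ᵇ (d ∸ 1)

isGeneric : ℕ × ℕ → Bool
isGeneric v = not (isWhite v ∨ isBlack v)

allB : {X : Set} → (X → Bool) → List X → Bool
allB p []       = true
allB p (x ∷ xs) = p x ∧ allB p xs

isPlabicTree : Tree → Bool
isPlabicTree t = grassRoot t ∧ allB (λ v → not (isGeneric v)) (verts t)

clash : ℕ × ℕ → ℕ × ℕ → Bool
clash u v = (isWhite u ∧ isWhite v) ∨ (isBlack u ∧ isBlack v)

module _ {A : Set} where
  noClash : ℕ × ℕ → List (Br A) → Bool
  noClash u []                   = true
  noClash u (bdry _ ∷ cs)        = noClash u cs
  noClash u (node h' cs' ∷ cs)   = not (clash u (h' , suc (length cs'))) ∧ noClash u cs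

  mutual
    contr : Br A → Bool
    contr (bdry _)    = true
    contr (node h cs) = noClash (h , suc (length cs)) cs ∧ contrL cs

    contrL : List (Br A) → Bool
    contrL []       = true
    contrL (c ∷ cs) = contr c ∧ contrL cs

isContractedPlabicTree : Tree → Bool
isContractedPlabicTree t = isPlabicTree t ∧ contr t

-- Helicity (doubled, to stay in ℤ) and momentum amplituhedron dimension

sumℤ : List ℤ → ℤ
sumℤ []       = + 0
sumℤ (x ∷ xs) = x + sumℤ xs

mapL : {X Y : Set} → (X → Y) → List X → List Y
mapL f []       = []
mapL f (x ∷ xs) = f x ∷ mapL f xs

-- 2·(h(v) - deg(v)/2)
hel2v : ℕ × ℕ → ℤ
hel2v (h , d) = (+ 2) * (+ h) - + d

hel2Tree : Tree → ℤ
hel2Tree t = sumℤ (mapL hel2v (verts t)) + + treeN t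

mv : ℕ × ℕ → ℤ
mv (h , d) = if isGeneric (h , d) then (+ 2) * (+ d) - + 4 else + d - + 1

dimTree : Tree → ℤ
dimTree t = if treeN t ≤ᵇ 2 then + treeN t - + 1
            else + 1 + sumℤ (mapL (λ v → mv v - + 1) (verts t))

-- Planar forests in a disk with boundary b₁,…,bₙ.
-- Either empty (n = 0), or: the component T containing b₁, encoded as
-- the branch hanging off b₁, where every non-root boundary vertex of T
-- carries the forest lying in the boundary gap clockwise after it, and
-- 'gap' is the forest in the gap clockwise after b₁.

data Forest : Set where
  emptyF : Forest
  grow   : (gap : Forest) → Br Forest → Forest

mutual
  strip : Br Forest → Tree
  strip (bdry _)    = bdry _
  strip (node h cs) = node h (stripL cs)

  stripL : List (Br Forest) → List Tree
  stripL []       = []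
  stripL (c ∷ cs) = strip c ∷ stripL cs

mutual
  comps : Forest → List Tree
  comps emptyF     = []
  comps (grow g t) = strip t ∷ (comps g ++ compsBr t)

  compsBr : Br Forest → List Tree
  compsBr (bdry f)    = comps f
  compsBr (node _ cs) = compsL cs

  compsL : List (Br Forest) → List Tree
  compsL []       = []
  compsL (c ∷ cs) = compsBr c ++ compsL cs

concatL : {X : Set} → List (List X) → List X
concatL []         = []
concatL (xs ∷ xss) = xs ++ concatL xss

sumℕ : List ℕ → ℕ
sumℕ []       = 0
sumℕ (x ∷ xs) = x ℕ.+ sumℕ xs

forestN : Forest → ℕ
forestN f = sumℕ (mapL treeN (comps f))

-- plabic forest: every component (a Grassmannian tree) is plabic;
-- contracted: no adjacent equal-coloured internal vertices (adjacency
-- only occurs inside components)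
isContractedPlabicForest : Forest → Bool
isContractedPlabicForest f = allB isContractedPlabicTree (comps f)

hel2Forest : Forest → ℤ
hel2Forest f = sumℤ (mapL hel2v (concatL (mapL verts (comps f)))) + + forestN f

dimForest : Forest → ℤ
dimForest f = sumℤ (mapL dimTree (comps f))

-- contracted plabic trees / forests with n boundary vertices, type (k,n)
-- (i.e. h(G) = k, i.e. 2h(G) = 2k) and momentum amplituhedron dimension r
CTree : ℤ → ℤ → ℤ → Tree → Set
CTree n k r t = (isContractedPlabicTree t ≡ true) × (+ treeN t ≡ n)
              × (hel2Tree t ≡ (+ 2) * k) × (dimTree t ≡ r)

CForest : ℤ → ℤ → ℤ → Forest → Set
CForest n k r f = (isContractedPlabicForest f ≡ true) × (+ forestN f ≡ n)
                × (hel2Forest f ≡ (+ 2) * k) × (dimForest f ≡ r)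

-- Formal power series in x, y, q with integer coefficients:
-- s a b c = [x^a y^b q^c] s.

Series : Set
Series = ℕ → ℕ → ℕ → ℤ

_≈ₛ_ : Series → Series → Set
f ≈ₛ g = ∀ a b c → f a b c ≡ g a b c

sumTo : ℕ → (ℕ → ℤ) → ℤ
sumTo zero    f = f 0
sumTo (suc n) f = sumTo n f + f (suc n)

zeroₛ : Series
zeroₛ _ _ _ = + 0

oneₛ : Series
oneₛ 0 0 0 = + 1
oneₛ _ _ _ = + 0

Xₛ : Series
Xₛ 1 0 0 = + 1
Xₛ _ _ _ = + 0

Yₛ : Series
Yₛ 0 1 0 = + 1
Yₛ _ _ _ = + 0

Qₛ : Series
Qₛ 0 0 1 = + 1
Qₛ _ _ _ = + 0

_+ₛ_ : Series → Series → Series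
(f +ₛ g) a b c = f a b c + g a b c

_-ₛ_ : Series → Series → Series
(f -ₛ g) a b c = f a b c - g a b c

_*ₛ_ : Series → Series → Series
(f *ₛ g) a b c =
  sumTo a λ i → sumTo b λ j → sumTo c λ l →
    f i j l * g (a ∸ i) (b ∸ j) (c ∸ l)

infixl 6 _+ₛ_ _-ₛ_
infixl 7 _*ₛ_
infix 4 _≈ₛ_

powₛ : Series → ℕ → Series
powₛ f zero    = oneₛ
powₛ f (suc m) = f *ₛ powₛ f m

xCoeff : Series → ℕ → Series
xCoeff f m zero    b c = f m b c
xCoeff f m (suc _) b c = + 0

-- composition in x: (f ∘ g)(x) = Σ_m [x^m]f · g(x)^m ; meaningful when
-- [x^0] g = 0 (then only m ≤ a contribute to [x^a])
_∘ₛ_ : Series → Series → Series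
(f ∘ₛ g) a b c = sumTo a λ m → (xCoeff f m *ₛ powₛ g m) a b c

NoConstX : Series → Set
NoConstX f = ∀ b c → f 0 b c ≡ + 0

IsCompInverse : Series → Series → Set
IsCompInverse f g = NoConstX f × NoConstX g × (f ∘ₛ g ≈ₛ Xₛ) × (g ∘ₛ f ≈ₛ Xₛ)

coeff : Series → ℤ → ℤ → ℤ → ℤ
coeff f (+ a) (+ b) (+ c) = f a b c
coeff f _     _     _     = + 0

IsC : Series → Set
IsC C = C *ₛ ((oneₛ +ₛ Xₛ *ₛ Qₛ) *ₛ (oneₛ +ₛ Xₛ *ₛ Yₛ *ₛ Qₛ))
        ≈ₛ Xₛ *ₛ (oneₛ -ₛ Qₛ *ₛ Qₛ *ₛ Xₛ *ₛ Xₛ *ₛ Yₛ)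

Ptree : Series → Series
Ptree Cinv = Xₛ *ₛ (oneₛ +ₛ Yₛ +ₛ Yₛ *ₛ Qₛ *ₛ Cinv)

{-# OPTIONS --safe #-}
-- Let u, v and B count the branches hanging off an edge whose root is not
-- white, not black, and arbitrary, with y and q normalised so that the single
-- edge is x.  A vertex of a given colour with its c ≥ 2 children is a first child
-- followed by a non-empty list of children, and such lists are again counted
-- by B: a single child is a branch, and a longer list is the list of children
-- of a vertex of that colour.  Hence the white and black branches are counted by
-- quB and yqvB, so u = B/(1+qB), v = B/(1+yqB), and x = u + v - B reads x = C(B).
-- A forest is empty or consists of the component of b₁ with a forest in the gap
-- after each of its boundary vertices, which replaces x by H = xP_forest in the
-- tree series; this gives H = x(1 + P_tree(H)).  Both equations have a unique
-- solution without constant term.  The coefficient formula is Lagrange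
-- inversion, proved with the derivation θ = x d/dx and without Laurent series.
module Submission where

open import Defs
open import Level using (0ℓ)
open import Data.Nat as ℕ using (ℕ; zero; suc; _∸_; _≤_; _<_; z≤n; s≤s)
import Data.Nat.Properties as ℕ
open import Data.Product using (_,_)
open import Relation.Binary.PropositionalEquality as ≡ using ()
open import Algebra.Bundles using (CommutativeSemiring)
open import Algebra.Structures.Biased using (isCommutativeSemiringˡ)
import Algebra.Properties.Semiring.Mult as Mult
import Algebra.Properties.CommutativeMonoid.Mult as CMult
import Algebra.Solver.Ring.NaturalCoefficients.Default as Solver
import Relation.Binary.Reasoning.Setoid as SetoidReasoning

-- Counting the edges of a tree gives n - 2 = Σ (deg v - 2) over its internal vertices. For n ≥ 2
-- the halves in the helicity therefore cancel against n/2, which leaves k = 1 + Σ (deg v - 2) over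
-- the black vertices, and the dimension is r = n - 1 = 1 + Σ (deg v - 2) over all internal
-- vertices. Both statistics are thus additive over vertices, and the two leading 1's are the factor
-- yq in P_tree. No generating function is available until every set of objects of fixed weight is
-- known to be finite, so finiteness comes before any equation. The inverses are known only through
-- their equations, so they are matched with the generating functions by uniqueness rather than by
-- computation. The algebra avoids subtraction: over an arbitrary commutative semiring the
-- construction of power series can be iterated, for q, then y, then x. Where differences or
-- quotients by integers would be natural, cancellation is assumed instead.

module FormalPowerSeries where

  -- Kept general in `R`, because the same identities are applied to coefficients, to series over
  -- them, and to natural numbers and integers.
  module Identities (R : CommutativeSemiring 0ℓ 0ℓ) where
    open CommutativeSemiring R
    open Solver R using (solve; _:=_; _:+_; _:*_; con)

    rotate : ∀ a b c → a + (b + c) ≈ b + (a + c)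
    rotate = solve 3 (λ a b c → a :+ (b :+ c) := b :+ (a :+ c)) refl

    middle-swap : ∀ a b c d → (a + b) + (c + d) ≈ (a + c) + (b + d)
    middle-swap = solve 4 (λ a b c d → (a :+ b) :+ (c :+ d) := (a :+ c) :+ (b :+ d)) refl

    swapʳ : ∀ a b c → a + b + c ≈ a + c + b
    swapʳ = solve 3 (λ a b c → a :+ b :+ c := a :+ c :+ b) refl

    horner-* : ∀ f g s t u h → f * g + h * (f * t + s * u) ≈ f * (g + h * t) + (h * s) * u
    horner-* = solve 6 (λ f g s t u h → f :* g :+ h :* (f :* t :+ s :* u) := f :* (g :+ h :* t) :+ (h :* s) :* u) refl

    chain-step : ∀ t g s u → t * u + g * (s * t) ≈ (u + g * s) * t
    chain-step = solve 4 (λ t g s u → t :* u :+ g :* (s :* t) := (u :+ g :* s) :* t) refl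

    lagrange-expand : ∀ p w t g s → (p * w) * (t * p + g * s) ≈ (p * (p * w)) * t + (g * p) * (w * s)
    lagrange-expand = solve 5 (λ p w t g s → (p :* w) :* (t :* p :+ g :* s) := (p :* (p :* w)) :* t :+ (g :* p) :* (w :* s)) refl

    bürmann-step : ∀ p w t c g u → ((p * w) * t) * (c + g * u) ≈ c * ((p * w) * t) + (g * p) * ((w * t) * u)
    bürmann-step = solve 6 (λ p w t c g u → ((p :* w) :* t) :* (c :+ g :* u) := c :* ((p :* w) :* t) :+ (g :* p) :* ((w :* t) :* u)) refl

    cube : ∀ q y b → b * (q * q * b * b * y) ≈ (b * b) * (q * q * b * y)
    cube = solve 3 (λ q y b → b :* (q :* q :* b :* b :* y) := (b :* b) :* (q :* q :* b :* y)) refl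

    pull-two : ∀ x t u → (x * t) * (x * u) ≈ x * (x * (t * u))
    pull-two = solve 3 (λ x t u → (x :* t) :* (x :* u) := x :* (x :* (t :* u))) refl

  module BranchAlgebra (R : CommutativeSemiring 0ℓ 0ℓ) where
    open CommutativeSemiring R
    open Solver R using (solve; _:=_; _:+_; _:*_; con)
    open SetoidReasoning setoid

    -- `A`, `W` and `K` stand for the branches that are a leaf, have a white root, or have a black
    -- root. Hence `A + K` is the u of the overview and `A + W` its v.
    viaWhite : ∀ {q A W K B} → B ≈ A + W + K → W ≈ q * ((A + K) * B) → B ≈ (A + K) * (1# + B * q)
    viaWhite {q} {A} {W} {K} {B} eB eW = begin
      B ≈⟨ eB ⟩
      A + W + K ≈⟨ +-congʳ (+-congˡ eW) ⟩
      A + q * ((A + K) * B) + K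
        ≈⟨ solve 4 (λ A K B q → A :+ q :* ((A :+ K) :* B) :+ K := (A :+ K) :* (con 1 :+ B :* q)) refl A K B q ⟩
      (A + K) * (1# + B * q) ∎

    viaBlack : ∀ {q y A W K B} → B ≈ A + W + K → K ≈ y * q * ((A + W) * B) → B ≈ (A + W) * (1# + B * y * q)
    viaBlack {q} {y} {A} {W} {K} {B} eB eK = begin
      B ≈⟨ eB ⟩
      A + W + K ≈⟨ +-congˡ eK ⟩
      A + W + y * q * ((A + W) * B)
        ≈⟨ solve 5 (λ A W B q y → A :+ W :+ y :* q :* ((A :+ W) :* B) := (A :+ W) :* (con 1 :+ B :* y :* q)) refl A W B q y ⟩
      (A + W) * (1# + B * y * q) ∎

    -- Both sides are increased by K(1+qB)(1+yqB) = yqB²(1+qB).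
    branchEq : (∀ x y z → x + z ≈ y + z → x ≈ y) → ∀ {q y A W K B} →
               B ≈ A + W + K → W ≈ q * ((A + K) * B) → K ≈ y * q * ((A + W) * B) →
               A * ((1# + B * q) * (1# + B * y * q)) + B * (q * q * B * B * y) ≈ B
    branchEq +-cancel {q} {y} {A} {W} {K} {B} eB eW eK = +-cancel _ _ (y * q * (B * B)) (begin
      A * (U * V) + B * (q * q * B * B * y) + y * q * (B * B)
        ≈⟨ solve 6 (λ A U V y B q → A :* (U :* V) :+ B :* (q :* q :* B :* B :* y) :+ y :* q :* (B :* B)
                      := A :* (U :* V) :+ y :* q :* (B :* (con 1 :+ B :* q)) :* B) refl A U V y B q ⟩
      A * (U * V) + y * q * (B * U) * B
        ≈⟨ +-congˡ (*-congʳ (*-congˡ (*-congʳ (viaBlack eB eK)))) ⟩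
      A * (U * V) + y * q * (((A + W) * V) * U) * B
        ≈⟨ solve 6 (λ A U V yq v B → A :* (U :* V) :+ yq :* ((v :* V) :* U) :* B
                      := (A :+ yq :* (v :* B)) :* (U :* V)) refl A U V (y * q) (A + W) B ⟩
      (A + y * q * ((A + W) * B)) * (U * V) ≈⟨ *-congʳ (+-congˡ eK) ⟨
      (A + K) * (U * V) ≈⟨ *-assoc _ _ _ ⟨
      (A + K) * U * V ≈⟨ *-congʳ (viaWhite eB eW) ⟨
      B * V ≈⟨ solve 3 (λ B y q → B :* (con 1 :+ B :* y :* q) := B :+ y :* q :* (B :* B)) refl B y q ⟩
      B + y * q * (B * B) ∎)
      where
      U V : Carrier
      U = 1# + B * q
      V = 1# + B * y * q

  -- Power series in one variable over a commutative semiring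

  module PowerSeries (R : CommutativeSemiring 0ℓ 0ℓ) where
    open CommutativeSemiring R renaming (Carrier to C)
    open Identities R using (rotate; middle-swap)
    open Mult semiring using () renaming (_×_ to _×′_)
    open SetoidReasoning setoid

    Ser : Set
    Ser = ℕ → C

    infix 4 _≋_
    _≋_ : Ser → Ser → Set
    f ≋ g = ∀ n → f n ≈ g n

    tail : Ser → Ser
    tail f n = f (suc n)

    infixl 6 _⊹_
    _⊹_ : Ser → Ser → Ser
    (f ⊹ g) n = f n + g n

    infixr 7 _·_
    _·_ : C → Ser → Ser
    (c · f) n = c * f n

    const : C → Ser
    const c zero    = c
    const c (suc _) = 0#

    𝟘 𝟙 X : Ser
    𝟘 _ = 0#
    𝟙 = const 1#
    X 1 = 1#
    X _ = 0#

    infixl 7 _✶_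
    -- The Cauchy product by recursion on the index, from f = f(0) + x · `tail f`. Ring laws become
    -- inductions that never touch an indexed sum.
    _✶_ : Ser → Ser → Ser
    (f ✶ g) zero    = f 0 * g 0
    (f ✶ g) (suc n) = f 0 * g (suc n) + (tail f ✶ g) n

    infix 4 _≈[_]_
    -- Congruence modulo x^a. Identities between composed series and the uniqueness of solutions are
    -- proved by induction on this precision.
    _≈[_]_ : Ser → ℕ → Ser → Set
    f ≈[ a ] g = ∀ {n} → n < a → f n ≈ g n

    ≈[]⇒≋ : ∀ {f g} → (∀ a → f ≈[ a ] g) → f ≋ g
    ≈[]⇒≋ p n = p (suc n) ℕ.≤-refl

    ✶-cong[] : ∀ a {f f′ g g′} → f ≈[ a ] f′ → g ≈[ a ] g′ → (f ✶ g) ≈[ a ] (f′ ✶ g′)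
    ✶-cong[] (suc a) p q {zero}  _         = *-cong (p (s≤s z≤n)) (q (s≤s z≤n))
    ✶-cong[] (suc a) p q {suc n} (s≤s n<a) =
      +-cong (*-cong (p (s≤s z≤n)) (q (s≤s n<a)))
             (✶-cong[] a (λ i<a → p (s≤s i<a)) (λ i<a → q (ℕ.m≤n⇒m≤1+n i<a)) n<a)

    -- A factor without constant term shifts the other one, whose unknown coefficients then enter
    -- one place later. This gain drives every induction on the precision.
    ✶-gain : ∀ a {f f′ g g′} → f 0 ≈ 0# → f′ 0 ≈ 0# → f ≈[ suc a ] f′ → g ≈[ a ] g′ → (f ✶ g) ≈[ suc a ] (f′ ✶ g′)
    ✶-gain a {g = g} {g′} z z′ p q {zero}  _         = trans (trans (*-congʳ z) (zeroˡ _)) (sym (trans (*-congʳ z′) (zeroˡ _)))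
    ✶-gain a {g = g} {g′} z z′ p q {suc n} (s≤s n<a) =
      +-cong (trans (trans (*-congʳ z) (zeroˡ _)) (sym (trans (*-congʳ z′) (zeroˡ _))))
             (✶-cong[] a (λ i<a → p (s≤s i<a)) q n<a)

    ✶-cong : ∀ {f f′ g g′} → f ≋ f′ → g ≋ g′ → f ✶ g ≋ f′ ✶ g′
    ✶-cong p q n = ✶-cong[] (suc n) (λ _ → p _) (λ _ → q _) ℕ.≤-refl

    ✶-zeroˡ : ∀ f → 𝟘 ✶ f ≋ 𝟘
    ✶-zeroˡ f zero    = zeroˡ _
    ✶-zeroˡ f (suc n) = trans (+-cong (zeroˡ _) (✶-zeroˡ f n)) (+-identityˡ _)

    const-✶ : ∀ c f → const c ✶ f ≋ c · f
    const-✶ c f zero    = refl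
    const-✶ c f (suc n) = trans (+-congˡ (✶-zeroˡ f n)) (+-identityʳ _)

    ✶-distribʳ : ∀ h f g → (f ⊹ g) ✶ h ≋ (f ✶ h) ⊹ (g ✶ h)
    ✶-distribʳ h f g zero    = distribʳ _ _ _
    ✶-distribʳ h f g (suc n) =
      trans (+-cong (distribʳ _ _ _) (✶-distribʳ h (tail f) (tail g) n)) (middle-swap _ _ _ _)

    ·-✶ : ∀ c f g → (c · f) ✶ g ≋ c · (f ✶ g)
    ·-✶ c f g zero    = *-assoc _ _ _
    ·-✶ c f g (suc n) = trans (+-cong (*-assoc _ _ _) (·-✶ c (tail f) g n)) (sym (distribˡ _ _ _))

    -- The recursion of `✶` peels its left factor. Peeling the right factor as well is what
    -- commutativity amounts to.
    ✶-snoc : ∀ f g n → (f ✶ g) (suc n) ≈ (f ✶ tail g) n + f (suc n) * g 0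
    ✶-snoc f g zero    = refl
    ✶-snoc f g (suc n) = trans (+-congˡ (✶-snoc (tail f) g n)) (sym (+-assoc _ _ _))

    ✶-comm : ∀ f g → f ✶ g ≋ g ✶ f
    ✶-comm f g zero    = *-comm _ _
    ✶-comm f g (suc n) = begin
      f 0 * g (suc n) + (tail f ✶ g) n ≈⟨ +-cong (*-comm _ _) (✶-comm (tail f) g n) ⟩
      g (suc n) * f 0 + (g ✶ tail f) n ≈⟨ +-comm _ _ ⟩
      (g ✶ tail f) n + g (suc n) * f 0 ≈⟨ ✶-snoc g f n ⟨
      (g ✶ f) (suc n)                  ∎

    ✶-assoc : ∀ f g h → (f ✶ g) ✶ h ≋ f ✶ (g ✶ h)
    ✶-assoc f g h zero    = *-assoc _ _ _
    ✶-assoc f g h (suc n) = begin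
      f 0 * g 0 * h (suc n) + ((f 0 · tail g ⊹ tail f ✶ g) ✶ h) n
        ≈⟨ +-cong (*-assoc _ _ _) (✶-distribʳ h (f 0 · tail g) (tail f ✶ g) n) ⟩
      f 0 * (g 0 * h (suc n)) + (((f 0 · tail g) ✶ h) n + ((tail f ✶ g) ✶ h) n)
        ≈⟨ +-congˡ (+-cong (·-✶ (f 0) (tail g) h n) (✶-assoc (tail f) g h n)) ⟩
      f 0 * (g 0 * h (suc n)) + (f 0 * (tail g ✶ h) n + (tail f ✶ (g ✶ h)) n)
        ≈⟨ +-assoc _ _ _ ⟨
      f 0 * (g 0 * h (suc n)) + f 0 * (tail g ✶ h) n + (tail f ✶ (g ✶ h)) n
        ≈⟨ +-congʳ (distribˡ _ _ _) ⟨
      f 0 * (g ✶ h) (suc n) + (tail f ✶ (g ✶ h)) n ∎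

    ✶-identityˡ : ∀ f → 𝟙 ✶ f ≋ f
    ✶-identityˡ f n = trans (const-✶ 1# f n) (*-identityˡ _)

    series : CommutativeSemiring 0ℓ 0ℓ
    series = record
      { Carrier = Ser ; _≈_ = _≋_ ; _+_ = _⊹_ ; _*_ = _✶_ ; 0# = 𝟘 ; 1# = 𝟙
      ; isCommutativeSemiring = isCommutativeSemiringˡ record
        { +-isCommutativeMonoid = record
          { isMonoid = record
            { isSemigroup = record
              { isMagma = record
                { isEquivalence = record
                  { refl  = λ _ → refl
                  ; sym   = λ p n → sym (p n)
                  ; trans = λ p q n → trans (p n) (q n) }
                ; ∙-cong = λ p q n → +-cong (p n) (q n) }
              ; assoc = λ _ _ _ _ → +-assoc _ _ _ }
            ; identity = (λ _ _ → +-identityˡ _) , (λ _ _ → +-identityʳ _) }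
          ; comm = λ _ _ _ → +-comm _ _ }
        ; *-isCommutativeMonoid = record
          { isMonoid = record
            { isSemigroup = record
              { isMagma = record
                { isEquivalence = record
                  { refl  = λ _ → refl
                  ; sym   = λ p n → sym (p n)
                  ; trans = λ p q n → trans (p n) (q n) }
                ; ∙-cong = ✶-cong }
              ; assoc = ✶-assoc }
            ; identity = ✶-identityˡ , (λ f n → trans (✶-comm f 𝟙 n) (✶-identityˡ f n)) }
          ; comm = ✶-comm }
        ; distribʳ = ✶-distribʳ
        ; zeroˡ = ✶-zeroˡ } }

    tail-X : tail X ≋ 𝟙
    tail-X zero    = refl
    tail-X (suc _) = refl

    X-✶-suc : ∀ f n → (X ✶ f) (suc n) ≈ f n
    X-✶-suc f n = begin
      0# * f (suc n) + (tail X ✶ f) n ≈⟨ +-cong (zeroˡ _) (✶-cong tail-X (λ _ → refl) n) ⟩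
      0# + (𝟙 ✶ f) n                  ≈⟨ +-identityˡ _ ⟩
      (𝟙 ✶ f) n                       ≈⟨ ✶-identityˡ f n ⟩
      f n ∎

    Σ≤ : ℕ → Ser → C
    Σ≤ zero    F = F 0
    Σ≤ (suc n) F = Σ≤ n F + F (suc n)

    Σ≤-cong : ∀ n {F G : Ser} → (∀ i → i ≤ n → F i ≈ G i) → Σ≤ n F ≈ Σ≤ n G
    Σ≤-cong zero    p = p 0 z≤n
    Σ≤-cong (suc n) p = +-cong (Σ≤-cong n (λ i i≤n → p i (ℕ.m≤n⇒m≤1+n i≤n))) (p (suc n) ℕ.≤-refl)

    Σ≤-head : ∀ n F → Σ≤ (suc n) F ≈ F 0 + Σ≤ n (tail F)
    Σ≤-head zero    F = refl
    Σ≤-head (suc n) F = trans (+-congʳ (Σ≤-head n F)) (+-assoc _ _ _)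

    Σ≤-conv : ∀ n f g → Σ≤ n (λ i → f i * g (n ∸ i)) ≈ (f ✶ g) n
    Σ≤-conv zero    f g = refl
    Σ≤-conv (suc n) f g =
      trans (Σ≤-head n (λ i → f i * g (suc n ∸ i))) (+-congˡ (Σ≤-conv n (tail f) g))

    -- Powers and composition

    pow : Ser → ℕ → Ser
    pow f zero    = 𝟙
    pow f (suc m) = f ✶ pow f m

    ✶-vanish : ∀ a f {g} → (∀ {i} → i < a → g i ≈ 0#) → ∀ {n} → n < a → (f ✶ g) n ≈ 0#
    ✶-vanish a f {g} p {n} n<a = begin
      (f ✶ g) n ≈⟨ ✶-cong[] a (λ _ → refl) p n<a ⟩
      (f ✶ 𝟘) n ≈⟨ ✶-comm f 𝟘 n ⟩
      (𝟘 ✶ f) n ≈⟨ ✶-zeroˡ f n ⟩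
      0# ∎

    pow-vanish : ∀ {h} → h 0 ≈ 0# → ∀ m {a} → a < m → pow h m a ≈ 0#
    pow-vanish {h} z (suc m) {zero}  _         = trans (*-congʳ z) (zeroˡ _)
    pow-vanish {h} z (suc m) {suc a} (s≤s a<m) = begin
      h 0 * pow h m (suc a) + (tail h ✶ pow h m) a
        ≈⟨ +-cong (trans (*-congʳ z) (zeroˡ _)) (✶-vanish m (tail h) (pow-vanish z m) a<m) ⟩
      0# + 0# ≈⟨ +-identityˡ _ ⟩
      0# ∎

    infixl 8 _⊚_
    _⊚_ : Ser → Ser → Ser
    (f ⊚ h) a = Σ≤ a (λ m → f m * pow h m a)

    -- `⊚` cuts its sum at the index of the coefficient asked for, so its cutoff varies. With a
    -- fixed cutoff the sum is a finite combination of series; as `pow h m` starts at x^m when h has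
    -- no constant term, every cutoff from the index on gives the same coefficient.
    partial : ℕ → Ser → Ser → Ser
    partial N f h a = Σ≤ N (λ m → f m * pow h m a)

    partial-extend : ∀ {h} → h 0 ≈ 0# → ∀ f a d → partial (d ℕ.+ a) f h a ≈ (f ⊚ h) a
    partial-extend z f a zero    = refl
    partial-extend {h} z f a (suc d) = begin
      partial (d ℕ.+ a) f h a + f (suc d ℕ.+ a) * pow h (suc d ℕ.+ a) a
        ≈⟨ +-cong (partial-extend z f a d)
                  (trans (*-congˡ (pow-vanish z (suc d ℕ.+ a) (s≤s (ℕ.m≤n+m a d)))) (zeroʳ _)) ⟩
      (f ⊚ h) a + 0# ≈⟨ +-identityʳ _ ⟩
      (f ⊚ h) a ∎

    partial-≤ : ∀ {h} → h 0 ≈ 0# → ∀ f {a N} → a ≤ N → partial N f h a ≈ (f ⊚ h) a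
    partial-≤ {h} z f {a} {N} a≤N =
      ≡.subst (λ M → partial M f h a ≈ (f ⊚ h) a) (ℕ.m∸n+n≡m a≤N) (partial-extend z f a (N ∸ a))

    Σ≤-✶ : ∀ N h (F : ℕ → Ser) a → Σ≤ N (λ m → (h ✶ F m) a) ≈ (h ✶ (λ i → Σ≤ N (λ m → F m i))) a
    Σ≤-✶ zero    h F a = refl
    Σ≤-✶ (suc N) h F a =
      trans (+-congʳ (Σ≤-✶ N h F a))
            (sym (trans (✶-comm h _ a) (trans (✶-distribʳ h _ _ a) (+-cong (✶-comm _ h a) (✶-comm _ h a)))))

    ·-✶ʳ : ∀ c h f → h ✶ (c · f) ≋ c · (h ✶ f)
    ·-✶ʳ c h f n = trans (✶-comm h _ n) (trans (·-✶ c f h n) (*-congˡ (✶-comm f h n)))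

    -- Horner's rule. The factor h gains one coefficient, so multiplicativity and the chain rule for
    -- composition follow by induction on the precision.
    ⊚-horner : ∀ {h} → h 0 ≈ 0# → ∀ f → f ⊚ h ≋ const (f 0) ⊹ h ✶ (tail f ⊚ h)
    ⊚-horner {h} z f a = begin
      (f ⊚ h) a ≈⟨ partial-≤ z f (ℕ.n≤1+n a) ⟨
      Σ≤ (suc a) (λ m → f m * pow h m a) ≈⟨ Σ≤-head a (λ m → f m * pow h m a) ⟩
      f 0 * 𝟙 a + Σ≤ a (λ m → f (suc m) * (h ✶ pow h m) a)
        ≈⟨ +-cong (scale-𝟙 a) (Σ≤-cong a (λ m _ → sym (·-✶ʳ (f (suc m)) h (pow h m) a))) ⟩
      const (f 0) a + Σ≤ a (λ m → (h ✶ (f (suc m) · pow h m)) a)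
        ≈⟨ +-congˡ (Σ≤-✶ a h (λ m → f (suc m) · pow h m) a) ⟩
      const (f 0) a + (h ✶ partial a (tail f) h) a
        ≈⟨ +-congˡ (✶-cong[] (suc a) (λ _ → refl) (λ { (s≤s i≤a) → partial-≤ z (tail f) i≤a }) ℕ.≤-refl) ⟩
      const (f 0) a + (h ✶ (tail f ⊚ h)) a ∎
      where
      scale-𝟙 : ∀ a → f 0 * 𝟙 a ≈ const (f 0) a
      scale-𝟙 zero    = *-identityʳ _
      scale-𝟙 (suc _) = zeroʳ _

    ⊚-cong : ∀ {f g h} → f ≋ g → f ⊚ h ≋ g ⊚ h
    ⊚-cong p a = Σ≤-cong a (λ m _ → *-congʳ (p m))

    ⊚-⊹ : ∀ f g h → (f ⊹ g) ⊚ h ≋ f ⊚ h ⊹ g ⊚ h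
    ⊚-⊹ f g h a = go a
      where
      go : ∀ N → partial N (f ⊹ g) h a ≈ partial N f h a + partial N g h a
      go zero    = distribʳ _ _ _
      go (suc N) = trans (+-cong (go N) (distribʳ _ _ _)) (middle-swap _ _ _ _)

    ⊚-· : ∀ c f h → (c · f) ⊚ h ≋ c · (f ⊚ h)
    ⊚-· c f h a = go a
      where
      go : ∀ N → partial N (c · f) h a ≈ c * partial N f h a
      go zero    = *-assoc _ _ _
      go (suc N) = trans (+-cong (go N) (*-assoc _ _ _)) (sym (distribˡ _ _ _))

    ⊚-const : ∀ {h} → h 0 ≈ 0# → ∀ c → const c ⊚ h ≋ const c
    ⊚-const {h} z c a = begin
      (const c ⊚ h) a ≈⟨ ⊚-horner z (const c) a ⟩
      const c a + (h ✶ (𝟘 ⊚ h)) a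
        ≈⟨ +-congˡ (✶-vanish (suc a) h (λ {i} _ → zero-⊚ i) ℕ.≤-refl) ⟩
      const c a + 0# ≈⟨ +-identityʳ _ ⟩
      const c a ∎
      where
      zero-⊚ : ∀ i → (𝟘 ⊚ h) i ≈ 0#
      zero-⊚ i = go i
        where
        go : ∀ N → partial N 𝟘 h i ≈ 0#
        go zero    = zeroˡ _
        go (suc N) = trans (+-cong (go N) (zeroˡ _)) (+-identityˡ _)

    X-⊚ : ∀ {h} → h 0 ≈ 0# → X ⊚ h ≋ h
    X-⊚ {h} z a = begin
      (X ⊚ h) a ≈⟨ ⊚-horner z X a ⟩
      const 0# a + (h ✶ (tail X ⊚ h)) a
        ≈⟨ +-cong (const-0 a) (✶-cong (λ _ → refl) tail-X-⊚ a) ⟩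
      0# + (h ✶ 𝟙) a ≈⟨ +-identityˡ _ ⟩
      (h ✶ 𝟙) a ≈⟨ ✶-comm h 𝟙 a ⟩
      (𝟙 ✶ h) a ≈⟨ ✶-identityˡ h a ⟩
      h a ∎
      where
      const-0 : ∀ a → const 0# a ≈ 0#
      const-0 zero    = refl
      const-0 (suc _) = refl
      tail-X-⊚ : tail X ⊚ h ≋ 𝟙
      tail-X-⊚ n = trans (⊚-cong {h = h} tail-X n) (⊚-const z 1# n)

    private
      module S where
        open CommutativeSemiring series public
        open Identities series public

    ⊚-✶ : ∀ {h} → h 0 ≈ 0# → ∀ f g → (f ✶ g) ⊚ h ≋ (f ⊚ h) ✶ (g ⊚ h)
    ⊚-✶ {h} z f g = ≈[]⇒≋ (λ a → go a f g)
      where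
      const-* : ∀ c d → const (c * d) ≋ const c ✶ const d
      const-* c d zero    = refl
      const-* c d (suc n) = sym (trans (const-✶ c (const d) (suc n)) (zeroʳ _))
      go : ∀ a f g → (f ✶ g) ⊚ h ≈[ a ] (f ⊚ h) ✶ (g ⊚ h)
      go zero    f g ()
      go (suc a) f g {n} n<a = begin
        ((f ✶ g) ⊚ h) n ≈⟨ ⊚-horner z (f ✶ g) n ⟩
        const (f 0 * g 0) n + (h ✶ ((f 0 · tail g ⊹ tail f ✶ g) ⊚ h)) n
          ≈⟨ +-cong (const-* (f 0) (g 0) n) (✶-gain a z z (λ _ → refl) inner n<a) ⟩
        (const (f 0) ✶ const (g 0) ⊹ h ✶ (const (f 0) ✶ (tail g ⊚ h) ⊹ (tail f ⊚ h) ✶ (g ⊚ h))) n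
          ≈⟨ S.horner-* (const (f 0)) (const (g 0)) (tail f ⊚ h) (tail g ⊚ h) (g ⊚ h) h n ⟩
        (const (f 0) ✶ (const (g 0) ⊹ h ✶ (tail g ⊚ h)) ⊹ (h ✶ (tail f ⊚ h)) ✶ (g ⊚ h)) n
          ≈⟨ +-congʳ (✶-cong (λ _ → refl) (λ i → sym (⊚-horner z g i)) n) ⟩
        (const (f 0) ✶ (g ⊚ h) ⊹ (h ✶ (tail f ⊚ h)) ✶ (g ⊚ h)) n
          ≈⟨ ✶-distribʳ (g ⊚ h) (const (f 0)) (h ✶ (tail f ⊚ h)) n ⟨
        ((const (f 0) ⊹ h ✶ (tail f ⊚ h)) ✶ (g ⊚ h)) n
          ≈⟨ ✶-cong (λ i → sym (⊚-horner z f i)) (λ _ → refl) n ⟩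
        ((f ⊚ h) ✶ (g ⊚ h)) n ∎
        where
        inner : (f 0 · tail g ⊹ tail f ✶ g) ⊚ h
                ≈[ a ] const (f 0) ✶ (tail g ⊚ h) ⊹ (tail f ⊚ h) ✶ (g ⊚ h)
        inner {i} i<a = trans (⊚-⊹ (f 0 · tail g) (tail f ✶ g) h i)
          (+-cong (trans (⊚-· (f 0) (tail g) h i) (sym (const-✶ (f 0) (tail g ⊚ h) i)))
                  (go a (tail f) g i<a))

    -- The derivation θ and Lagrange inversion

    θ : Ser → Ser
    θ f n = n ×′ f n

    -- The ordinary derivative occurs only inside a composition: the chain rule for θ reads θ(f∘h) =
    -- (f′∘h) · θh.
    ∂ : Ser → Ser
    ∂ f n = suc n ×′ f (suc n)

    open Mult semiring using (×-comm-*; ×-congʳ)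
    open CMult +-commutativeMonoid using (×-distrib-+)
    module SM = Mult S.semiring

    ×-zero : ∀ k → k ×′ 0# ≈ 0#
    ×-zero zero    = refl
    ×-zero (suc k) = trans (+-identityˡ _) (×-zero k)

    θ-cong : ∀ {f g} → f ≋ g → θ f ≋ θ g
    θ-cong p n = ×-congʳ n (p n)

    θ-⊹ : ∀ f g → θ (f ⊹ g) ≋ θ f ⊹ θ g
    θ-⊹ f g n = ×-distrib-+ _ _ n

    θ-✶ : ∀ f g → θ (f ✶ g) ≋ θ f ✶ g ⊹ f ✶ θ g
    θ-✶ f g zero    = sym (trans (+-cong (zeroˡ _) (zeroʳ _)) (+-identityˡ _))
    θ-✶ f g (suc n) = begin
      suc n ×′ (f 0 * g (suc n) + (tail f ✶ g) n)
        ≈⟨ ×-distrib-+ _ _ (suc n) ⟩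
      suc n ×′ (f 0 * g (suc n)) + ((tail f ✶ g) n + n ×′ (tail f ✶ g) n)
        ≈⟨ +-cong (sym (×-comm-* (suc n) _ _)) (+-congˡ (θ-✶ (tail f) g n)) ⟩
      f 0 * θ g (suc n) + ((tail f ✶ g) n + ((θ (tail f) ✶ g) n + (tail f ✶ θ g) n))
        ≈⟨ +-congˡ (sym (+-assoc _ _ _)) ⟩
      f 0 * θ g (suc n) + ((tail f ✶ g) n + (θ (tail f) ✶ g) n + (tail f ✶ θ g) n)
        ≈⟨ rotate _ _ _ ⟩
      (tail f ✶ g) n + (θ (tail f) ✶ g) n + (f 0 * θ g (suc n) + (tail f ✶ θ g) n)
        ≈⟨ +-congʳ (✶-distribʳ g (tail f) (θ (tail f)) n) ⟨
      (tail (θ f) ✶ g) n + (f ✶ θ g) (suc n)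
        ≈⟨ +-congʳ (trans (+-congʳ (zeroˡ _)) (+-identityˡ _)) ⟨
      (θ f ✶ g) (suc n) + (f ✶ θ g) (suc n) ∎

    ×-coeff : ∀ m f n → (m SM.× f) n ≈ m ×′ f n
    ×-coeff zero    f n = refl
    ×-coeff (suc m) f n = +-congˡ (×-coeff m f n)

    θ-pow : ∀ f m → θ (pow f (suc m)) ≋ suc m SM.× (pow f m ✶ θ f)
    θ-pow f zero n = begin
      θ (f ✶ 𝟙) n         ≈⟨ θ-cong (S.*-identityʳ f) n ⟩
      θ f n               ≈⟨ S.*-identityˡ (θ f) n ⟨
      (𝟙 ✶ θ f) n         ≈⟨ SM.×-homo-1 (𝟙 ✶ θ f) n ⟨
      (1 SM.× (𝟙 ✶ θ f)) n ∎
    θ-pow f (suc m) n = begin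
      θ (f ✶ pow f (suc m)) n ≈⟨ θ-✶ f (pow f (suc m)) n ⟩
      (θ f ✶ pow f (suc m) ⊹ f ✶ θ (pow f (suc m))) n
        ≈⟨ +-cong (✶-comm (θ f) (pow f (suc m)) n)
             (trans (✶-cong (λ _ → refl) (θ-pow f m) n)
               (trans (SM.×-comm-* (suc m) f (pow f m ✶ θ f) n)
                      (SM.×-congʳ (suc m) (λ i → sym (✶-assoc f (pow f m) (θ f) i)) n))) ⟩
      (suc (suc m) SM.× (pow f (suc m) ✶ θ f)) n ∎

    ∂-tail : ∀ f → ∂ f ≋ tail f ⊹ X ✶ ∂ (tail f)
    ∂-tail f zero    = +-congˡ (sym (zeroˡ _))
    ∂-tail f (suc n) = +-congˡ (sym (X-✶-suc (∂ (tail f)) n))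

    θ-⊚ : ∀ {h} → h 0 ≈ 0# → ∀ f → θ (f ⊚ h) ≋ (∂ f ⊚ h) ✶ θ h
    θ-⊚ {h} z f = ≈[]⇒≋ (λ a → go a f)
      where
      θ-const : ∀ c → θ (const c) ≋ 𝟘
      θ-const c zero    = refl
      θ-const c (suc n) = go′ (suc n)
        where
        go′ : ∀ k → k ×′ 0# ≈ 0#
        go′ zero    = refl
        go′ (suc k) = trans (+-identityˡ _) (go′ k)
      go : ∀ a f → θ (f ⊚ h) ≈[ a ] (∂ f ⊚ h) ✶ θ h
      go zero    f ()
      go (suc a) f {n} n<a = begin
        θ (f ⊚ h) n ≈⟨ θ-cong (⊚-horner z f) n ⟩
        θ (const (f 0) ⊹ h ✶ (tail f ⊚ h)) n
          ≈⟨ trans (θ-⊹ (const (f 0)) (h ✶ (tail f ⊚ h)) n) (+-cong (θ-const (f 0) n) (θ-✶ h (tail f ⊚ h) n)) ⟩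
        0# + ((θ h ✶ (tail f ⊚ h)) n + (h ✶ θ (tail f ⊚ h)) n)
          ≈⟨ +-identityˡ _ ⟩
        (θ h ✶ (tail f ⊚ h)) n + (h ✶ θ (tail f ⊚ h)) n
          ≈⟨ +-congˡ (✶-gain a z z (λ _ → refl) (go a (tail f)) n<a) ⟩
        (θ h ✶ (tail f ⊚ h) ⊹ h ✶ ((∂ (tail f) ⊚ h) ✶ θ h)) n
          ≈⟨ S.chain-step (θ h) h (∂ (tail f) ⊚ h) (tail f ⊚ h) n ⟩
        ((tail f ⊚ h ⊹ h ✶ (∂ (tail f) ⊚ h)) ✶ θ h) n
          ≈⟨ ✶-cong (λ i → sym (∂-⊚ i)) (λ _ → refl) n ⟩
        ((∂ f ⊚ h) ✶ θ h) n ∎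
        where
        ∂-⊚ : ∂ f ⊚ h ≋ tail f ⊚ h ⊹ h ✶ (∂ (tail f) ⊚ h)
        ∂-⊚ i = trans (⊚-cong {h = h} (∂-tail f) i) (trans (⊚-⊹ (tail f) (X ✶ ∂ (tail f)) h i)
          (+-congˡ (trans (⊚-✶ z X (∂ (tail f)) i) (✶-cong (X-⊚ z) (λ _ → refl) i))))

    θX : θ X ≋ X
    θX zero          = refl
    θX (suc zero)    = +-identityʳ _
    θX (suc (suc n)) = ×-zero (suc (suc n))

    -- The two cancellation laws stand in for subtraction and for division by positive integers. The
    -- relation G · φ = x lets φ^m / x^m play the part of G^(-m), so no negative powers appear.
    module Lagrange
      (+-cancel : ∀ x y z → x + z ≈ y + z → x ≈ y)
      (×-cancel : ∀ n x y → suc n ×′ x ≈ suc n ×′ y → x ≈ y)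
      {φ G : Ser} (G₀ : G 0 ≈ 0#) (Gφ≋X : G ✶ φ ≋ X)
      where

      θ-relation : θ G ✶ φ ⊹ G ✶ θ φ ≋ X
      θ-relation n = trans (sym (θ-✶ G φ n)) (trans (θ-cong Gφ≋X n) (θX n))

      residue₀ : (pow φ 1 ✶ θ G) 1 ≈ 1#
      residue₀ = begin
        (pow φ 1 ✶ θ G) 1
          ≈⟨ S.trans (✶-cong (S.*-identityʳ φ) (λ _ → refl)) (✶-comm φ (θ G)) 1 ⟩
        (θ G ✶ φ) 1 ≈⟨ +-identityʳ _ ⟨
        (θ G ✶ φ) 1 + 0#
          ≈⟨ +-congˡ (trans (+-cong (trans (*-congʳ G₀) (zeroˡ _)) (zeroʳ _)) (+-identityʳ _)) ⟨
        (θ G ✶ φ) 1 + (G ✶ θ φ) 1 ≈⟨ θ-relation 1 ⟩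
        1# ∎

      -- With m = j + 2, this is the constant term of G^(-m) θG, which is θ(G^(1-m)) up to the
      -- factor 1 - m, and θ kills constant terms. The exponent m = 1 is the logarithmic derivative,
      -- with residue 1 in `residue₀`. To stay within power series, the relation θG · φ + G · θφ = x
      -- is multiplied by φ^(j+1) instead.
      residue : ∀ j → (pow φ (suc (suc j)) ✶ θ G) (suc (suc j)) ≈ 0#
      residue j = +-cancel _ _ (p (suc j)) (begin
        (pow φ (suc (suc j)) ✶ θ G) (suc (suc j)) + p (suc j)
          ≈⟨ +-congˡ (trans (×-cancel j _ _ power) (sym (X-✶-suc (pow φ j ✶ θ φ) (suc j)))) ⟩
        (pow φ (suc (suc j)) ✶ θ G) (suc (suc j)) + (X ✶ (pow φ j ✶ θ φ)) (suc (suc j))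
          ≈⟨ +-congˡ (✶-cong Gφ≋X (λ _ → refl) (suc (suc j))) ⟨
        (pow φ (suc (suc j)) ✶ θ G) (suc (suc j)) + ((G ✶ φ) ✶ (pow φ j ✶ θ φ)) (suc (suc j))
          ≈⟨ S.lagrange-expand φ (pow φ j) (θ G) G (θ φ) (suc (suc j)) ⟨
        (p ✶ (θ G ✶ φ ⊹ G ✶ θ φ)) (suc (suc j))
          ≈⟨ S.trans (✶-cong {p} (λ _ → refl) θ-relation) (✶-comm p X) (suc (suc j)) ⟩
        (X ✶ p) (suc (suc j)) ≈⟨ X-✶-suc p (suc j) ⟩
        p (suc j) ≈⟨ +-identityˡ _ ⟨
        0# + p (suc j) ∎)
        where
        p : Ser
        p = pow φ (suc j)
        -- At index j + 1 the derivation multiplies by j + 1, which is also the factor of the power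
        -- rule; the two cancel.
        power : suc j ×′ p (suc j) ≈ suc j ×′ (pow φ j ✶ θ φ) (suc j)
        power = trans (θ-pow φ j (suc j)) (×-coeff (suc j) (pow φ j ✶ θ φ) (suc j))

      -- The coefficients of f are the residues of φ^{n+1} θG (f∘G) / x^{n+1},
      -- which is G^{-n-1} θG (f∘G) when G = x/φ.
      bürmann : ∀ n f → (pow φ (suc n) ✶ θ G ✶ (f ⊚ G)) (suc n) ≈ f n
      bürmann n f = begin
        (pow φ (suc n) ✶ θ G ✶ (f ⊚ G)) (suc n)
          ≈⟨ ✶-cong {pow φ (suc n) ✶ θ G} (λ _ → refl) (⊚-horner G₀ f) (suc n) ⟩
        (pow φ (suc n) ✶ θ G ✶ (const (f 0) ⊹ G ✶ (tail f ⊚ G))) (suc n)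
          ≈⟨ S.bürmann-step φ (pow φ n) (θ G) (const (f 0)) G (tail f ⊚ G) (suc n) ⟩
        (const (f 0) ✶ (pow φ (suc n) ✶ θ G)) (suc n) + ((G ✶ φ) ✶ (pow φ n ✶ θ G ✶ (tail f ⊚ G))) (suc n)
          ≈⟨ +-cong (const-✶ (f 0) (pow φ (suc n) ✶ θ G) (suc n))
               (trans (✶-cong Gφ≋X (λ _ → refl) (suc n)) (X-✶-suc (pow φ n ✶ θ G ✶ (tail f ⊚ G)) n)) ⟩
        f 0 * (pow φ (suc n) ✶ θ G) (suc n) + (pow φ n ✶ θ G ✶ (tail f ⊚ G)) n
          ≈⟨ last n ⟩
        f n ∎
        where
        last : ∀ n → f 0 * (pow φ (suc n) ✶ θ G) (suc n) + (pow φ n ✶ θ G ✶ (tail f ⊚ G)) n ≈ f n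
        last zero    = trans (+-cong (trans (*-congˡ residue₀) (*-identityʳ _))
                                     (trans (*-congʳ (zeroʳ _)) (zeroˡ _)))
                             (+-identityʳ _)
        last (suc j) = trans (+-cong (trans (*-congˡ (residue j)) (zeroʳ _)) (bürmann j (tail f)))
                             (+-identityˡ _)

      -- This is `bürmann` for f = H′: by the chain rule (H′∘G) · θG = θ(H∘G) = θx = x, so only
      -- φ^(n+1) · x is left.
      lagrange : ∀ {H} → H ⊚ G ≋ X → ∀ n → suc n ×′ H (suc n) ≈ pow φ (suc n) n
      lagrange {H} HG≋X n = begin
        ∂ H n ≈⟨ bürmann n (∂ H) ⟨
        (pow φ (suc n) ✶ θ G ✶ (∂ H ⊚ G)) (suc n)
          ≈⟨ S.trans (✶-assoc (pow φ (suc n)) (θ G) (∂ H ⊚ G))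
               (✶-cong {pow φ (suc n)} (λ _ → refl)
                 (S.trans (✶-comm (θ G) (∂ H ⊚ G))
                   (S.trans (S.sym (θ-⊚ G₀ H)) (S.trans (θ-cong HG≋X) θX)))) (suc n) ⟩
        (pow φ (suc n) ✶ X) (suc n) ≈⟨ ✶-comm (pow φ (suc n)) X (suc n) ⟩
        (X ✶ pow φ (suc n)) (suc n) ≈⟨ X-✶-suc (pow φ (suc n)) n ⟩
        pow φ (suc n) n ∎

    -- In contrast to `✶-gain`, neither factor need be known beyond a coefficients, since the error
    -- of each is multiplied by a series divisible by x. It serves the square of the unknown in the
    -- cubic term of the branch equation.
    ✶-gain₂ : ∀ a {f f′ g g′} → f 0 ≈ 0# → f′ 0 ≈ 0# → g 0 ≈ 0# → g′ 0 ≈ 0# →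
              f ≈[ a ] f′ → g ≈[ a ] g′ → f ✶ g ≈[ suc a ] f′ ✶ g′
    ✶-gain₂ zero    z z′ w w′ p q = ✶-gain 0 z z′ (λ { (s≤s z≤n) → trans z (sym z′) }) (λ ())
    ✶-gain₂ (suc a) {f} {f′} {g} {g′} z z′ w w′ p q {n} n<a = begin
      (f ✶ g) n ≈⟨ split z w n ⟩
      (X ✶ (X ✶ (tail f ✶ tail g))) n
        ≈⟨ ✶-gain (suc a) {X} refl refl (λ _ → refl) (✶-gain a {X} refl refl (λ _ → refl)
             (✶-cong[] a (λ i<a → p (s≤s i<a)) (λ i<a → q (s≤s i<a)))) n<a ⟩
      (X ✶ (X ✶ (tail f′ ✶ tail g′))) n ≈⟨ split z′ w′ n ⟨
      (f′ ✶ g′) n ∎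
      where
      X-tail : ∀ {f} → f 0 ≈ 0# → f ≋ X ✶ tail f
      X-tail {f} z zero    = trans z (sym (zeroˡ _))
      X-tail {f} z (suc n) = sym (X-✶-suc (tail f) n)
      split : ∀ {f g} → f 0 ≈ 0# → g 0 ≈ 0# → f ✶ g ≋ X ✶ (X ✶ (tail f ✶ tail g))
      split {f} {g} z w = S.trans (✶-cong (X-tail z) (X-tail w)) (S.pull-two X (tail f) (tail g))

    -- The equation A = B(1 - q²yB²) / ((1+qB)(1+yqB)) without denominators or subtraction.
    BranchEq : Ser → Ser → Ser → Ser → Set
    BranchEq q y A B = A ✶ ((𝟙 ⊹ B ✶ q) ✶ (𝟙 ⊹ B ✶ y ✶ q)) ⊹ B ✶ (q ✶ q ✶ B ✶ B ✶ y) ≋ B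

    -- The number of known coefficients of B grows by one with each use of the equation.
    branch-step : ∀ q y a {A A′ B B′} → A 0 ≈ 0# → A′ 0 ≈ 0# → B 0 ≈ 0# → B′ 0 ≈ 0# →
                  BranchEq q y A B → BranchEq q y A′ B′ →
                  A ≈[ suc a ] A′ → B ≈[ a ] B′ → B ≈[ suc a ] B′
    branch-step q y a {A} {A′} {B} {B′} A₀ A₀′ B₀ B₀′ e e′ p r {n} n<a =
      trans (sym (e n)) (trans (+-cong linear cubic) (e′ n))
      where
      id≈ : ∀ f → f ≈[ a ] f
      id≈ _ _ = refl
      linear = ✶-gain a A₀ A₀′ p
        (✶-cong[] a (λ i → +-congˡ (✶-cong[] a r (id≈ q) i))
                    (λ i → +-congˡ (✶-cong[] a (✶-cong[] a r (id≈ y)) (id≈ q) i))) n<a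
      cubic : (B ✶ (q ✶ q ✶ B ✶ B ✶ y)) n ≈ (B′ ✶ (q ✶ q ✶ B′ ✶ B′ ✶ y)) n
      cubic = trans (S.cube q y B n) (trans
        (✶-gain a (trans (*-congʳ B₀) (zeroˡ _)) (trans (*-congʳ B₀′) (zeroˡ _))
          (✶-gain₂ a B₀ B₀′ B₀ B₀′ r r)
          (✶-cong[] a (✶-cong[] a (id≈ (q ✶ q)) r) (id≈ y)) n<a)
        (sym (S.cube q y B′ n)))

open FormalPowerSeries
open import Data.Bool using (Bool; true; false; _∧_; not)
import Data.Bool.Properties as Bool
open import Data.Empty using (⊥-elim)
open import Data.Fin using (Fin; zero)
open import Data.Fin.Permutation using (↔⇒≡)
open import Data.Fin.Properties using (0↔⊥; 1↔⊤; +↔⊎; *↔×)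
open import Data.Integer as ℤ using (ℤ; +_; -[1+_]; _+_; _*_; _-_)
import Data.Integer.Properties as ℤ
open import Data.Integer.Tactic.RingSolver using (solve-∀)
open import Data.List using (List; []; _∷_; length; _++_)
open import Data.List.Properties using (∷-injective; ++-conicalˡ; ++-conicalʳ)
open import Data.Nat using (_≡ᵇ_)
open import Data.Product using (Σ; _×_; proj₁; proj₂; map₂)
open import Data.Product.Properties using (≡-dec; ,-injectiveʳ-≡)
open import Data.Product.Function.NonDependent.Propositional using (_×-↔_)
open import Data.Sum using (_⊎_; inj₁; inj₂; [_,_])
open import Data.Sum.Function.Propositional using (_⊎-↔_)
open import Data.Unit using (⊤; tt)
open import Algebra.Properties.AbelianGroup ℤ.+-0-abelianGroup using (∙-cancelʳ)
open import Axiom.UniquenessOfIdentityProofs using (UIP; module Decidable⇒UIP)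
open import Function.Bundles using (_↔_; mk↔ₛ′; module Inverse)
open import Function.Properties.Inverse using (↔-sym; ↔-trans)
open import Relation.Nullary using (¬_)
open import Relation.Binary.PropositionalEquality using (_≡_; _≢_; refl; sym; trans; cong; cong₂; subst)

-- Series in x, y and q

module PSq = PowerSeries ℤ.+-*-commutativeSemiring
module PSy = PowerSeries PSq.series
module PSx = PowerSeries PSy.series

open PSx using (_✶_; _⊹_; _⊚_; 𝟙; pow; BranchEq; _≈[_]_)
module 𝕊 = CommutativeSemiring PSx.series

sumTo-cong : ∀ n {F G : ℕ → ℤ} → (∀ i → F i ≡ G i) → sumTo n F ≡ sumTo n G
sumTo-cong zero    p = p 0
sumTo-cong (suc n) p = ≡.cong₂ ℤ._+_ (sumTo-cong n p) (p (suc n))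

sumTo-q : ∀ n F → sumTo n F ≡ PSq.Σ≤ n F
sumTo-q zero    F = ≡.refl
sumTo-q (suc n) F = ≡.cong (ℤ._+ F (suc n)) (sumTo-q n F)

sumTo-y : ∀ n F c → sumTo n (λ j → F j c) ≡ PSy.Σ≤ n F c
sumTo-y zero    F c = ≡.refl
sumTo-y (suc n) F c = ≡.cong (ℤ._+ F (suc n) c) (sumTo-y n F c)

sumTo-x : ∀ n F b c → sumTo n (λ i → F i b c) ≡ PSx.Σ≤ n F b c
sumTo-x zero    F b c = ≡.refl
sumTo-x (suc n) F b c = ≡.cong (ℤ._+ F (suc n) b c) (sumTo-x n F b c)

-- A `Series` is by definition a series in x over series in y over series in q, so only the products
-- have to be compared. The triple sum folds into three convolutions from the inside out.
*ₛ≈✶ : ∀ f g → f *ₛ g ≈ₛ f ✶ g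
*ₛ≈✶ f g a b c = begin
  (sumTo a λ i → sumTo b λ j → sumTo c λ l → f i j l ℤ.* g (a ∸ i) (b ∸ j) (c ∸ l))
    ≡⟨ sumTo-cong a (λ i → sumTo-cong b λ j → ≡.trans (sumTo-q c _) (PSq.Σ≤-conv c (f i j) (g (a ∸ i) (b ∸ j)))) ⟩
  (sumTo a λ i → sumTo b λ j → (f i j PSq.✶ g (a ∸ i) (b ∸ j)) c)
    ≡⟨ sumTo-cong a (λ i → ≡.trans (sumTo-y b (λ j → f i j PSq.✶ g (a ∸ i) (b ∸ j)) c) (PSy.Σ≤-conv b (f i) (g (a ∸ i)) c)) ⟩
  (sumTo a λ i → (f i PSy.✶ g (a ∸ i)) b c)
    ≡⟨ ≡.trans (sumTo-x a (λ i → f i PSy.✶ g (a ∸ i)) b c) (PSx.Σ≤-conv a f g b c) ⟩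
  (f ✶ g) a b c ∎
  where open ≡.≡-Reasoning

oneₛ≈𝟙 : oneₛ ≈ₛ 𝟙
oneₛ≈𝟙 zero    zero    zero    = ≡.refl
oneₛ≈𝟙 zero    zero    (suc _) = ≡.refl
oneₛ≈𝟙 zero    (suc _) _       = ≡.refl
oneₛ≈𝟙 (suc _) _       _       = ≡.refl

Xₛ≈X : Xₛ ≈ₛ PSx.X
Xₛ≈X zero          _       _       = ≡.refl
Xₛ≈X (suc zero)    zero    zero    = ≡.refl
Xₛ≈X (suc zero)    zero    (suc _) = ≡.refl
Xₛ≈X (suc zero)    (suc _) _       = ≡.refl
Xₛ≈X (suc (suc _)) _       _       = ≡.refl

Yₛ≈const : Yₛ ≈ₛ PSx.const (Yₛ 0)
Yₛ≈const zero    _ _ = ≡.refl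
Yₛ≈const (suc _) _ _ = ≡.refl

Qₛ≈const : Qₛ ≈ₛ PSx.const (Qₛ 0)
Qₛ≈const zero    _ _ = ≡.refl
Qₛ≈const (suc _) _ _ = ≡.refl

*ₛ-cong : ∀ {f f′ g g′} → f ≈ₛ f′ → g ≈ₛ g′ → f *ₛ g ≈ₛ f′ ✶ g′
*ₛ-cong {f} {g = g} p q = 𝕊.trans (*ₛ≈✶ f g) (𝕊.*-cong p q)

powₛ≈pow : ∀ {f g} → f ≈ₛ g → ∀ m → powₛ f m ≈ₛ pow g m
powₛ≈pow p zero    = oneₛ≈𝟙
powₛ≈pow p (suc m) = *ₛ-cong p (powₛ≈pow p m)

∘ₛ≈⊚ : ∀ f g → f ∘ₛ g ≈ₛ f ⊚ g
∘ₛ≈⊚ f g a b c = ≡.trans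
  (sumTo-cong a (λ m → ≡.trans (*ₛ-cong (xCoeff≈const m) (powₛ≈pow (λ _ _ _ → ≡.refl) m) a b c)
                               (PSx.const-✶ (f m) (pow g m) a b c)))
  (sumTo-x a (λ m → f m PSy.✶ pow g m a) b c)
  where
  xCoeff≈const : ∀ m → xCoeff f m ≈ₛ PSx.const (f m)
  xCoeff≈const m zero    _ _ = ≡.refl
  xCoeff≈const m (suc _) _ _ = ≡.refl

infixr 8 _×y_
_×y_ : ℕ → PSy.Ser → PSy.Ser
_×y_ = Mult._×_ (CommutativeSemiring.semiring PSy.series)

×y-coeff : ∀ m f b c → (m ×y f) b c ≡ + m ℤ.* f b c
×y-coeff zero    f b c = ≡.refl
×y-coeff (suc m) f b c = ≡.trans (≡.cong (ℤ._+_ (f b c)) (×y-coeff m f b c)) (≡.sym (ℤ.suc-* (+ m) (f b c)))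

+-cancel-y : ∀ (x y z : PSy.Ser) → (x PSy.⊹ z) PSy.≋ (y PSy.⊹ z) → x PSy.≋ y
+-cancel-y x y z p b c = ∙-cancelʳ (z b c) (x b c) (y b c) (p b c)

×y-cancel : ∀ n x y → (suc n ×y x) PSy.≋ (suc n ×y y) → x PSy.≋ y
×y-cancel n x y p b c = ℤ.*-cancelˡ-≡ (+ suc n) (x b c) (y b c)
  (≡.trans (≡.sym (×y-coeff (suc n) x b c)) (≡.trans (p b c) (×y-coeff (suc n) y b c)))

-- The functional equations of branches and forests

BranchEqₛ : Series → Series → Set
BranchEqₛ = BranchEq Qₛ Yₛ

module _ where
  open SetoidReasoning 𝕊.setoid

  -- Adding the subtracted term to both sides shows that (C, x) solves the branch equation.
  -- Composition with `Cinv` later turns this solution into (x, `Cinv`).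
  IsC⇒BranchEq : ∀ {C} → IsC C → BranchEqₛ C Xₛ
  IsC⇒BranchEq {C} isC = begin
    C ✶ ((𝟙 ⊹ Xₛ ✶ Qₛ) ✶ (𝟙 ⊹ Xₛ ✶ Yₛ ✶ Qₛ)) ⊹ Xₛ ✶ Z
      ≈⟨ 𝕊.+-congʳ (𝕊.*-congˡ {C} (𝕊.*-cong
           (𝕊.+-cong oneₛ≈𝟙 (*ₛ≈✶ Xₛ Qₛ))
           (𝕊.+-cong oneₛ≈𝟙 (*ₛ-cong (*ₛ≈✶ Xₛ Yₛ) (𝕊.refl {Qₛ}))))) ⟨
    C ✶ ((oneₛ +ₛ Xₛ *ₛ Qₛ) ✶ (oneₛ +ₛ Xₛ *ₛ Yₛ *ₛ Qₛ)) ⊹ Xₛ ✶ Z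
      ≈⟨ 𝕊.+-congʳ (*ₛ-cong (𝕊.refl {C}) (*ₛ≈✶ (oneₛ +ₛ Xₛ *ₛ Qₛ) (oneₛ +ₛ Xₛ *ₛ Yₛ *ₛ Qₛ))) ⟨
    C *ₛ ((oneₛ +ₛ Xₛ *ₛ Qₛ) *ₛ (oneₛ +ₛ Xₛ *ₛ Yₛ *ₛ Qₛ)) ⊹ Xₛ ✶ Z
      ≈⟨ 𝕊.+-congʳ isC ⟩
    Xₛ *ₛ (oneₛ -ₛ Zₛ) ⊹ Xₛ ✶ Z ≈⟨ 𝕊.+-congʳ {Xₛ ✶ Z} (*ₛ≈✶ Xₛ (oneₛ -ₛ Zₛ)) ⟩
    Xₛ ✶ (oneₛ -ₛ Zₛ) ⊹ Xₛ ✶ Z ≈⟨ 𝕊.distribˡ Xₛ (oneₛ -ₛ Zₛ) Z ⟨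
    Xₛ ✶ (oneₛ -ₛ Zₛ ⊹ Z) ≈⟨ 𝕊.*-congˡ {Xₛ} sub-add ⟩
    Xₛ ✶ 𝟙 ≈⟨ 𝕊.*-identityʳ Xₛ ⟩
    Xₛ ∎
    where
    Z Zₛ : Series
    Z = Qₛ ✶ Qₛ ✶ Xₛ ✶ Xₛ ✶ Yₛ
    Zₛ = Qₛ *ₛ Qₛ *ₛ Xₛ *ₛ Xₛ *ₛ Yₛ
    Zₛ≈Z : Zₛ ≈ₛ Z
    Zₛ≈Z = *ₛ-cong (*ₛ-cong (*ₛ-cong (*ₛ≈✶ Qₛ Qₛ) (𝕊.refl {Xₛ})) (𝕊.refl {Xₛ})) (𝕊.refl {Yₛ})
    sub-add : oneₛ -ₛ Zₛ ⊹ Z ≈ₛ 𝟙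
    sub-add a b c = ≡.trans (≡.cong (ℤ._+_ (oneₛ a b c ℤ.- Zₛ a b c)) (≡.sym (Zₛ≈Z a b c)))
      (≡.trans (ℤ.+-assoc (oneₛ a b c) (ℤ.- Zₛ a b c) (Zₛ a b c))
        (≡.trans (≡.cong (ℤ._+_ (oneₛ a b c)) (ℤ.+-inverseˡ (Zₛ a b c)))
          (≡.trans (ℤ.+-identityʳ _) (oneₛ≈𝟙 a b c))))

  BranchEq-cong : ∀ {A A′ B B′} → A ≈ₛ A′ → B ≈ₛ B′ → BranchEqₛ A B → BranchEqₛ A′ B′
  BranchEq-cong {A} {A′} {B} {B′} p r e = begin
    A′ ✶ ((𝟙 ⊹ B′ ✶ Qₛ) ✶ (𝟙 ⊹ B′ ✶ Yₛ ✶ Qₛ)) ⊹ B′ ✶ (Qₛ ✶ Qₛ ✶ B′ ✶ B′ ✶ Yₛ)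
      ≈⟨ 𝕊.+-cong (𝕊.*-cong p (𝕊.*-cong (𝕊.+-congˡ {𝟙} (𝕊.*-congʳ {Qₛ} r))
           (𝕊.+-congˡ {𝟙} (𝕊.*-congʳ {Qₛ} (𝕊.*-congʳ {Yₛ} r)))))
           (𝕊.*-cong r (𝕊.*-congʳ {Yₛ} (𝕊.*-cong (𝕊.*-congˡ {Qₛ ✶ Qₛ} r) r))) ⟨
    A ✶ ((𝟙 ⊹ B ✶ Qₛ) ✶ (𝟙 ⊹ B ✶ Yₛ ✶ Qₛ)) ⊹ B ✶ (Qₛ ✶ Qₛ ✶ B ✶ B ✶ Yₛ)
      ≈⟨ e ⟩
    B ≈⟨ r ⟩
    B′ ∎

  Q-⊚ : ∀ {h} → NoConstX h → Qₛ ⊚ h ≈ₛ Qₛ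
  Q-⊚ {h} z = 𝕊.trans (PSx.⊚-cong {h = h} Qₛ≈const) (𝕊.trans (PSx.⊚-const z (Qₛ 0)) (𝕊.sym {Qₛ} Qₛ≈const))

  Y-⊚ : ∀ {h} → NoConstX h → Yₛ ⊚ h ≈ₛ Yₛ
  Y-⊚ {h} z = 𝕊.trans (PSx.⊚-cong {h = h} Yₛ≈const) (𝕊.trans (PSx.⊚-const z (Yₛ 0)) (𝕊.sym {Yₛ} Yₛ≈const))

  X-⊚ₛ : ∀ {h} → NoConstX h → Xₛ ⊚ h ≈ₛ h
  X-⊚ₛ {h} z = 𝕊.trans (PSx.⊚-cong {h = h} Xₛ≈X) (PSx.X-⊚ z)

  ✶-⊚ : ∀ {h} → NoConstX h → ∀ f g {f′ g′} → f ⊚ h ≈ₛ f′ → g ⊚ h ≈ₛ g′ → (f ✶ g) ⊚ h ≈ₛ f′ ✶ g′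
  ✶-⊚ z f g p q = 𝕊.trans (PSx.⊚-✶ z f g) (𝕊.*-cong p q)

  ⊹-⊚ : ∀ {h} f g {f′ g′} → f ⊚ h ≈ₛ f′ → g ⊚ h ≈ₛ g′ → (f ⊹ g) ⊚ h ≈ₛ f′ ⊹ g′
  ⊹-⊚ {h} f g p q = 𝕊.trans (PSx.⊚-⊹ f g h) (𝕊.+-cong p q)

  -- Substitution for x is a homomorphism that fixes y and q, hence preserves any polynomial
  -- equation in A, B, y and q.
  BranchEq-⊚ : ∀ {A B h} → NoConstX h → BranchEqₛ A B → BranchEqₛ (A ⊚ h) (B ⊚ h)
  BranchEq-⊚ {A} {B} {h} z e = 𝕊.trans (𝕊.sym image) (PSx.⊚-cong {h = h} e)
    where
    one = PSx.⊚-const z 𝕊y.1#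
      where module 𝕊y = CommutativeSemiring PSy.series
    B⊚ = 𝕊.refl {B ⊚ h}
    BQ = ✶-⊚ z B Qₛ B⊚ (Q-⊚ z)
    BY = ✶-⊚ z B Yₛ B⊚ (Y-⊚ z)
    image = ⊹-⊚ (A ✶ ((𝟙 ⊹ B ✶ Qₛ) ✶ (𝟙 ⊹ B ✶ Yₛ ✶ Qₛ))) (B ✶ (Qₛ ✶ Qₛ ✶ B ✶ B ✶ Yₛ))
      (✶-⊚ z A ((𝟙 ⊹ B ✶ Qₛ) ✶ (𝟙 ⊹ B ✶ Yₛ ✶ Qₛ)) (𝕊.refl {A ⊚ h})
        (✶-⊚ z (𝟙 ⊹ B ✶ Qₛ) (𝟙 ⊹ B ✶ Yₛ ✶ Qₛ) (⊹-⊚ 𝟙 (B ✶ Qₛ) one BQ)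
          (⊹-⊚ 𝟙 (B ✶ Yₛ ✶ Qₛ) one (✶-⊚ z (B ✶ Yₛ) Qₛ BY (Q-⊚ z)))))
      (✶-⊚ z B (Qₛ ✶ Qₛ ✶ B ✶ B ✶ Yₛ) B⊚
        (✶-⊚ z (Qₛ ✶ Qₛ ✶ B ✶ B) Yₛ
          (✶-⊚ z (Qₛ ✶ Qₛ ✶ B) B (✶-⊚ z (Qₛ ✶ Qₛ) B (✶-⊚ z Qₛ Qₛ (Q-⊚ z) (Q-⊚ z)) B⊚) B⊚)
          (Y-⊚ z)))

  -- 1 + y for the two boundary leaves, yqB for all other trees.
  rootS : Series → Series
  rootS B = 𝟙 ⊹ Yₛ ⊹ Yₛ ✶ Qₛ ✶ B

  -- For B = `Cinv`(H) the product `H ✶ rootS B` is P_tree(H). Here B is a separate unknown, tied to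
  -- H by the branch equation, so that the combinatorial series fit the same system.
  ForestEq : Series → Series → Set
  ForestEq B H = H ≈ₛ Xₛ ✶ (𝟙 ⊹ H ✶ rootS B)

  Ptree≈ : ∀ {B B′} → B ≈ₛ B′ → Ptree B ≈ₛ Xₛ ✶ rootS B′
  Ptree≈ p = *ₛ-cong (𝕊.refl {Xₛ})
    (𝕊.+-cong (𝕊.+-congʳ {Yₛ} oneₛ≈𝟙) (*ₛ-cong (*ₛ≈✶ Yₛ Qₛ) p))

  -- Substitute H for x in G · (1 + P_tree) = x: the factor G becomes x and the right side becomes
  -- H.
  forestEq : ∀ {Cinv G H} → NoConstX H → G *ₛ (oneₛ +ₛ Ptree Cinv) ≈ₛ Xₛ → G ∘ₛ H ≈ₛ Xₛ →
             ForestEq (Cinv ⊚ H) H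
  forestEq {Cinv} {G} {H} z Gφ GH = begin
    H ≈⟨ X-⊚ₛ z ⟨
    Xₛ ⊚ H ≈⟨ PSx.⊚-cong {h = H} (𝕊.trans (𝕊.sym Gφ) (*ₛ-cong (𝕊.refl {G}) (𝕊.+-cong oneₛ≈𝟙 (Ptree≈ (𝕊.refl {Cinv}))))) ⟩
    (G ✶ (𝟙 ⊹ Xₛ ✶ rootS Cinv)) ⊚ H
      ≈⟨ ✶-⊚ z G (𝟙 ⊹ Xₛ ✶ rootS Cinv) (𝕊.trans (𝕊.sym (∘ₛ≈⊚ G H)) GH)
           (⊹-⊚ 𝟙 (Xₛ ✶ rootS Cinv) one (✶-⊚ z Xₛ (rootS Cinv) (X-⊚ₛ z)
             (⊹-⊚ (𝟙 ⊹ Yₛ) (Yₛ ✶ Qₛ ✶ Cinv) (⊹-⊚ 𝟙 Yₛ one (Y-⊚ z))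
               (✶-⊚ z (Yₛ ✶ Qₛ) Cinv (✶-⊚ z Yₛ Qₛ (Y-⊚ z) (Q-⊚ z)) (𝕊.refl {Cinv ⊚ H}))))) ⟩
    Xₛ ✶ (𝟙 ⊹ H ✶ rootS (Cinv ⊚ H)) ∎
    where
    one = PSx.⊚-const z (CommutativeSemiring.1# PSy.series)

branch-unique : ∀ {A B B′} → NoConstX A → NoConstX B → NoConstX B′ →
                BranchEqₛ A B → BranchEqₛ A B′ → B ≈ₛ B′
branch-unique {A} {B} {B′} A₀ B₀ B₀′ e e′ = PSx.≈[]⇒≋ go
  where
  go : ∀ a → B ≈[ a ] B′
  go zero    ()
  go (suc a) = PSx.branch-step Qₛ Yₛ a A₀ A₀ B₀ B₀′ e e′ (λ {n} _ → 𝕊.refl {A} n) (go a)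

-- Each round improves H first, thanks to the factor x in its equation; the improved H is then what
-- `branch-step` needs to improve B.
forest-unique : ∀ {B B′ H H′} → NoConstX B → NoConstX B′ → NoConstX H → NoConstX H′ →
                BranchEqₛ H B → BranchEqₛ H′ B′ → ForestEq B H → ForestEq B′ H′ → H ≈ₛ H′
forest-unique {B} {B′} {H} {H′} B₀ B₀′ H₀ H₀′ e e′ f f′ = PSx.≈[]⇒≋ (λ a → proj₂ (go a))
  where
  id≈ : ∀ a f → f ≈[ a ] f
  id≈ a f {n} _ = 𝕊.refl {f} n
  go : ∀ a → (B ≈[ a ] B′) × (H ≈[ a ] H′)
  go zero    = (λ ()) , (λ ())
  go (suc a) with go a
  ... | b , h = PSx.branch-step Qₛ Yₛ a H₀ H₀′ B₀ B₀′ e e′ h′ b , h′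
    where
    h′ : H ≈[ suc a ] H′
    h′ {n} n<a b c = ≡.trans (f n b c) (≡.trans
      (PSx.✶-gain a {Xₛ} {Xₛ} (λ _ _ → ≡.refl) (λ _ _ → ≡.refl) (id≈ (suc a) Xₛ)
        (λ {j} i<a b c → ≡.cong (ℤ._+_ (𝟙 j b c))
          (PSx.✶-cong[] a h (λ {i} i<a b c → ≡.cong (ℤ._+_ (𝟙 i b c ℤ.+ Yₛ i b c))
             (PSx.✶-cong[] a (id≈ a (Yₛ ✶ Qₛ)) (proj₁ (go a)) i<a b c)) i<a b c)) n<a b c)
      (≡.sym (f′ n b c)))

lagrangeₛ : ∀ {φ G H P} → G *ₛ φ ≈ₛ Xₛ → NoConstX G → H ∘ₛ G ≈ₛ Xₛ → Xₛ *ₛ P ≈ₛ H →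
            ∀ n k r → + (suc n) ℤ.* P n k r ≡ powₛ φ (suc n) n k r
lagrangeₛ {φ} {G} {H} {P} Gφ G₀ HG XP n k r = begin
  + (suc n) ℤ.* P n k r ≡⟨ ≡.cong (+ (suc n) ℤ.*_) (P≈ n k r) ⟩
  + (suc n) ℤ.* H (suc n) k r ≡⟨ ×y-coeff (suc n) (H (suc n)) k r ⟨
  (suc n ×y H (suc n)) k r
    ≡⟨ PSx.Lagrange.lagrange +-cancel-y ×y-cancel {φ} {G} G₀
         (𝕊.trans (𝕊.sym (*ₛ≈✶ G φ)) (𝕊.trans Gφ Xₛ≈X)) {H}
         (𝕊.trans (𝕊.sym (∘ₛ≈⊚ H G)) (𝕊.trans HG Xₛ≈X)) n k r ⟩
  pow φ (suc n) n k r ≡⟨ powₛ≈pow (𝕊.refl {φ}) (suc n) n k r ⟨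
  powₛ φ (suc n) n k r ∎
  where
  open ≡.≡-Reasoning
  P≈ : ∀ n k r → P n k r ≡ H (suc n) k r
  P≈ n k r = ≡.trans (≡.sym (PSx.X-✶-suc P n k r))
    (≡.trans (≡.sym (*ₛ-cong Xₛ≈X (𝕊.refl {P}) (suc n) k r)) (XP (suc n) k r))

-- Counting by weight

Finite : Set → Set
Finite A = Σ ℕ λ n → Fin n ↔ A

Count : Set → ℤ → Set
Count A z = Σ ℕ λ n → (Fin n ↔ A) × (+ n ≡ z)

Count⇒Finite : ∀ {A z} → Count A z → Finite A
Count⇒Finite = map₂ proj₁

Count-↔ : ∀ {A B z} → A ↔ B → Count A z → Count B z
Count-↔ i (n , j , e) = n , ↔-trans j i , e

Finite-↔ : ∀ {A B} → A ↔ B → Finite A → Finite B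
Finite-↔ i (n , j) = n , ↔-trans j i

-- The passage from bijections to equations: two series that count isomorphic classes have equal
-- coefficients.
Count-unique : ∀ {A y z} → Count A y → Count A z → y ≡ z
Count-unique (m , i , refl) (n , j , refl) = cong +_ (↔⇒≡ (↔-trans i (↔-sym j)))

Count-⊎ : ∀ {A B y z} → Count A y → Count B z → Count (A ⊎ B) (y ℤ.+ z)
Count-⊎ (m , i , refl) (n , j , refl) = m ℕ.+ n , ↔-trans +↔⊎ (i ⊎-↔ j) , refl

Count-× : ∀ {A B y z} → Count A y → Count B z → Count (A × B) (y ℤ.* z)
Count-× (m , i , refl) (n , j , refl) = m ℕ.* n , ↔-trans *↔× (i ×-↔ j) , ℤ.pos-* m n

Finite-⊎ : ∀ {A B} → Finite A → Finite B → Finite (A ⊎ B)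
Finite-⊎ (m , i) (n , j) = m ℕ.+ n , ↔-trans +↔⊎ (i ⊎-↔ j)

Count-⊥ : ∀ {A} → ¬ A → Count A (+ 0)
Count-⊥ ¬a = 0 , ↔-trans 0↔⊥ (mk↔ₛ′ ⊥-elim ¬a (λ a → ⊥-elim (¬a a)) (λ ())) , refl

-- `B` is shown finite only with the help of an element of `A`. In a product of classes it is the
-- weight of such an element that bounds what is left for the second factor.
Finite-× : ∀ {A B} → Finite A → (A → Finite B) → Finite (A × B)
Finite-× (zero  , i) _ = Count⇒Finite (Count-⊥ λ (a , _) → Inverse.to (↔-trans (↔-sym i) 0↔⊥) a)
Finite-× (suc m , i) f with f (Inverse.to i zero)
... | n , j = suc m ℕ.* n , ↔-trans *↔× (i ×-↔ j)

section⇒↔ : ∀ {A B : Set} (f : A → B) (g : B → A) → (∀ b → f (g b) ≡ b) →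
             (∀ {a a′} → f a ≡ f a′ → a ≡ a′) → A ↔ B
section⇒↔ f g fg inj = mk↔ₛ′ f g fg (λ a → inj (fg (f a)))

-- The counterpart of `sumTo` for types, so that the ways to split a weight are counted by the very
-- triple sum that defines `*ₛ`.
Below : ℕ → (ℕ → Set) → Set
Below n P = Σ ℕ λ i → (i ≤ n) × P i

Below-≡ : ∀ {n P} {x y : Below n P} →
          _≡_ {A = Σ ℕ P} (proj₁ x , proj₂ (proj₂ x)) (proj₁ y , proj₂ (proj₂ y)) → x ≡ y
Below-≡ {x = i , p , a} {_ , q , _} refl = cong (λ r → i , r , a) (ℕ.≤-irrelevant p q)

Below-zero : ∀ {P} → P 0 ↔ Below 0 P
Below-zero = mk↔ₛ′ (λ p → 0 , z≤n , p) (λ { (zero , _ , p) → p }) (λ { (zero , z≤n , p) → refl }) (λ _ → refl)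

Below-suc : ∀ {P} n → (Below n P ⊎ P (suc n)) ↔ Below (suc n) P
Below-suc {P} n = section⇒↔ f g fg inj
  where
  f : Below n P ⊎ P (suc n) → Below (suc n) P
  f (inj₁ (i , q , p)) = i , ℕ.m≤n⇒m≤1+n q , p
  f (inj₂ p)           = suc n , ℕ.≤-refl , p
  g : Below (suc n) P → Below n P ⊎ P (suc n)
  g (i , q , p) with ℕ.m≤n⇒m<n∨m≡n q
  ... | inj₁ (s≤s q′) = inj₁ (i , q′ , p)
  ... | inj₂ refl     = inj₂ p
  fg : ∀ b → f (g b) ≡ b
  fg (i , q , p) with ℕ.m≤n⇒m<n∨m≡n q
  ... | inj₁ (s≤s q′) = Below-≡ refl
  ... | inj₂ refl     = Below-≡ refl
  forget : Below (suc n) P → Σ ℕ P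
  forget (i , _ , p) = i , p
  same-index : ∀ {x y : Below n P ⊎ P (suc n)} → forget (f x) ≡ forget (f y) → x ≡ y
  same-index {inj₁ (i , q , p)} {inj₁ (_ , q′ , _)} refl = cong inj₁ (Below-≡ refl)
  same-index {inj₁ (_ , q , p)} {inj₂ _} refl = ⊥-elim (ℕ.<-irrefl refl q)
  same-index {inj₂ _} {inj₁ (_ , q , p)} refl = ⊥-elim (ℕ.<-irrefl refl q)
  same-index {inj₂ _} {inj₂ _} e = cong inj₂ (level e)
    where
    level : ∀ {m} {p p′ : P m} → _≡_ {A = Σ ℕ P} (m , p) (m , p′) → p ≡ p′
    level {m} {p} e = ,-injectiveʳ-≡ ℕ.≡-irrelevant e refl
  inj : ∀ {x y} → f x ≡ f y → x ≡ y
  inj e = same-index (cong forget e)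

Count-Below : ∀ {P} n {z : ℕ → ℤ} → (∀ i → i ≤ n → Count (P i) (z i)) → Count (Below n P) (sumTo n z)
Count-Below zero    c = Count-↔ Below-zero (c 0 z≤n)
Count-Below (suc n) c = Count-↔ (Below-suc n)
  (Count-⊎ (Count-Below n (λ i i≤n → c i (ℕ.m≤n⇒m≤1+n i≤n))) (c (suc n) ℕ.≤-refl))

Finite-Below : ∀ {P} n → (∀ i → i ≤ n → Finite (P i)) → Finite (Below n P)
Finite-Below zero    c = Finite-↔ Below-zero (c 0 z≤n)
Finite-Below (suc n) c = Finite-↔ (Below-suc n)
  (Finite-⊎ (Finite-Below n (λ i i≤n → c i (ℕ.m≤n⇒m≤1+n i≤n))) (c (suc n) ℕ.≤-refl))

-- Exponents of x, y and q.
Weight : Set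
Weight = ℕ × ℕ × ℕ

infixr 6 _⊕_
_⊕_ : Weight → Weight → Weight
(a , b , c) ⊕ (a′ , b′ , c′) = a ℕ.+ a′ , b ℕ.+ b′ , c ℕ.+ c′

Weight-UIP : UIP Weight
Weight-UIP = Decidable⇒UIP.≡-irrelevant (≡-dec ℕ._≟_ (≡-dec ℕ._≟_ ℕ._≟_))

record Class : Set₁ where
  constructor class
  field
    Obj : Set
    wt  : Obj → Weight
open Class

Fibre : Class → Weight → Set
Fibre A v = Σ (Obj A) λ x → wt A x ≡ v

infixr 5 _⊎ᶜ_
infixr 6 _×ᶜ_
infix  4 _≅_

_⊎ᶜ_ _×ᶜ_ : Class → Class → Class
A ⊎ᶜ B = class (Obj A ⊎ Obj B) [ wt A , wt B ]
A ×ᶜ B = class (Obj A × Obj B) (λ (x , y) → wt A x ⊕ wt B y)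

monomial : Weight → Class
monomial u = class ⊤ (λ _ → u)

_≅_ : Class → Class → Set
A ≅ B = Σ (Obj A ↔ Obj B) λ i → ∀ x → wt B (Inverse.to i x) ≡ wt A x

Fibre-≡ : ∀ A {v} {x y : Fibre A v} → proj₁ x ≡ proj₁ y → x ≡ y
Fibre-≡ A {x = x , p} {_ , q} refl = cong (x ,_) (Weight-UIP p q)

Fibre-≅ : ∀ {A B} → A ≅ B → ∀ v → Fibre A v ↔ Fibre B v
Fibre-≅ {A} {B} (i , w) v = section⇒↔
  (λ (x , e) → Inverse.to i x , trans (w x) e)
  (λ (y , e) → Inverse.from i y , trans (sym (w (Inverse.from i y)))
                 (trans (cong (wt B) (Inverse.strictlyInverseˡ i y)) e))
  (λ (y , _) → Fibre-≡ B (Inverse.strictlyInverseˡ i y))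
  (λ {a} {a′} e → Fibre-≡ A (trans (sym (Inverse.strictlyInverseʳ i (proj₁ a)))
     (trans (cong (λ z → Inverse.from i (proj₁ z)) e) (Inverse.strictlyInverseʳ i (proj₁ a′)))))

Fibre-⊎ : ∀ A B v → (Fibre A v ⊎ Fibre B v) ↔ Fibre (A ⊎ᶜ B) v
Fibre-⊎ A B v = mk↔ₛ′
  [ (λ (x , e) → inj₁ x , e) , (λ (y , e) → inj₂ y , e) ]
  (λ { (inj₁ x , e) → inj₁ (x , e) ; (inj₂ y , e) → inj₂ (y , e) })
  (λ { (inj₁ x , e) → refl ; (inj₂ y , e) → refl })
  (λ { (inj₁ x) → refl ; (inj₂ y) → refl })

Splits : Class → Class → Weight → Set
Splits A B (a , b , c) = Below a λ i → Below b λ j → Below c λ l →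
  Fibre A (i , j , l) × Fibre B (a ∸ i , b ∸ j , c ∸ l)

Fibre-× : ∀ A B v → Splits A B v ↔ Fibre (A ×ᶜ B) v
Fibre-× A B v@(a , b , c) = section⇒↔ f g (λ _ → Fibre-≡ (A ×ᶜ B) refl) (λ e → inj (cong proj₁ e))
  where
  f : Splits A B v → Fibre (A ×ᶜ B) v
  f (i , p , j , q , l , r , (x , ex) , (y , ey)) = (x , y) ,
    trans (cong₂ _⊕_ ex ey) (cong₂ _,_ (ℕ.m+[n∸m]≡n p) (cong₂ _,_ (ℕ.m+[n∸m]≡n q) (ℕ.m+[n∸m]≡n r)))
  g : Fibre (A ×ᶜ B) v → Splits A B v
  g ((x , y) , e) = let (i , j , l) = wt A x ; (i′ , j′ , l′) = wt B y in
    i , below (cong proj₁ e) ,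
    j , below (cong (λ u → proj₁ (proj₂ u)) e) ,
    l , below (cong (λ u → proj₂ (proj₂ u)) e) ,
    (x , refl) ,
    (y , cong₂ _,_ (rest (cong proj₁ e)) (cong₂ _,_
       (rest {j} (cong (λ u → proj₁ (proj₂ u)) e)) (rest {l} (cong (λ u → proj₂ (proj₂ u)) e))))
    where
    below : ∀ {i i′ n} → i ℕ.+ i′ ≡ n → i ≤ n
    below {i} refl = ℕ.m≤m+n i _
    rest : ∀ {i i′ n} → i ℕ.+ i′ ≡ n → i′ ≡ n ∸ i
    rest {i} {i′} refl = sym (ℕ.m+n∸m≡n i i′)
  inj : ∀ {s t} → proj₁ (f s) ≡ proj₁ (f t) → s ≡ t
  inj {i , p , j , q , l , r , (x , refl) , (y , ey)} {_ , p′ , _ , q′ , _ , r′ , (_ , refl) , (_ , ey′)} refl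
    rewrite ℕ.≤-irrelevant p p′ | ℕ.≤-irrelevant q q′ | ℕ.≤-irrelevant r r′ | Weight-UIP ey ey′ = refl

infix 4 _counts_
_counts_ : Series → Class → Set
s counts A = ∀ a b c → Count (Fibre A (a , b , c)) (s a b c)

counts-unique : ∀ {A s t} → s counts A → t counts A → s ≈ₛ t
counts-unique p q a b c = Count-unique (p a b c) (q a b c)

counts-≅ : ∀ {A B s} → A ≅ B → s counts A → s counts B
counts-≅ i p a b c = Count-↔ (Fibre-≅ i (a , b , c)) (p a b c)

counts-⊎ : ∀ {A B s t} → s counts A → t counts B → s +ₛ t counts A ⊎ᶜ B
counts-⊎ {A} {B} p q a b c = Count-↔ (Fibre-⊎ A B (a , b , c)) (Count-⊎ (p a b c) (q a b c))

counts-× : ∀ {A B s t} → s counts A → t counts B → s *ₛ t counts A ×ᶜ B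
counts-× {A} {B} p q a b c = Count-↔ (Fibre-× A B (a , b , c))
  (Count-Below a λ i _ → Count-Below b λ j _ → Count-Below c λ l _ →
    Count-× (p i j l) (q (a ∸ i) (b ∸ j) (c ∸ l)))

-- The degree that drops at every recursive step below; y need not be bounded
-- because the splits of a fixed weight are finite in number anyway.
deg : Weight → ℕ
deg (a , b , c) = a ℕ.+ c

FiniteBelow : ℕ → Class → Set
FiniteBelow N A = ∀ v → deg v < N → Finite (Fibre A v)

finite-≅ : ∀ {A B N} → A ≅ B → FiniteBelow N A → FiniteBelow N B
finite-≅ i p v d = Finite-↔ (Fibre-≅ i v) (p v d)

finite-⊎ : ∀ {A B N} → FiniteBelow N A → FiniteBelow N B → FiniteBelow N (A ⊎ᶜ B)
finite-⊎ {A} {B} p q v d = Finite-↔ (Fibre-⊎ A B v) (Finite-⊎ (p v d) (q v d))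

-- With δ = 1 a leading monomial pays for the recursive call; δ = 0 is for products whose payment
-- was made by a monomial further out.
finite-× : ∀ {A B N} δ → (∀ x → δ ≤ deg (wt A x)) → FiniteBelow (δ ℕ.+ N) A → FiniteBelow N B →
           FiniteBelow (δ ℕ.+ N) (A ×ᶜ B)
finite-× {A} {B} {N} δ δ≤ p q v@(a , b , c) d = Finite-↔ (Fibre-× A B v)
  (Finite-Below a λ i i≤a → Finite-Below b λ j _ → Finite-Below c λ l l≤c →
    Finite-× (p (i , j , l) (ℕ.≤-<-trans (ℕ.+-mono-≤ i≤a l≤c) d))
      λ { (x , refl) → q (a ∸ i , b ∸ j , c ∸ l) (rest-small (δ≤ x) i≤a l≤c) })
  where
  rest-small : ∀ {i l} → δ ≤ i ℕ.+ l → i ≤ a → l ≤ c → (a ∸ i) ℕ.+ (c ∸ l) < N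
  rest-small {i} {l} δ≤il i≤a l≤c = ℕ.+-cancelˡ-< δ _ _ (begin-strict
    δ ℕ.+ ((a ∸ i) ℕ.+ (c ∸ l)) ≤⟨ ℕ.+-monoˡ-≤ _ δ≤il ⟩
    (i ℕ.+ l) ℕ.+ ((a ∸ i) ℕ.+ (c ∸ l)) ≡⟨ middle-swap i l (a ∸ i) (c ∸ l) ⟩
    (i ℕ.+ (a ∸ i)) ℕ.+ (l ℕ.+ (c ∸ l)) ≡⟨ cong₂ ℕ._+_ (ℕ.m+[n∸m]≡n i≤a) (ℕ.m+[n∸m]≡n l≤c) ⟩
    a ℕ.+ c <⟨ d ⟩
    δ ℕ.+ N ∎)
    where
    open ℕ.≤-Reasoning
    open Identities ℕ.+-*-commutativeSemiring using (middle-swap)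

private
  Count-one : ∀ u → Count (Fibre (monomial u) u) (+ 1)
  Count-one u = 1 , ↔-trans 1↔⊤ (mk↔ₛ′ (λ _ → tt , refl) (λ _ → tt) (λ _ → Fibre-≡ (monomial u) refl) (λ _ → refl)) , refl

counts-1 : oneₛ counts monomial (0 , 0 , 0)
counts-1 zero    zero    zero    = Count-one _
counts-1 (suc _) _       _       = Count-⊥ λ ()
counts-1 zero    (suc _) _       = Count-⊥ λ ()
counts-1 zero    zero    (suc _) = Count-⊥ λ ()

counts-x : Xₛ counts monomial (1 , 0 , 0)
counts-x zero          _       _       = Count-⊥ λ ()
counts-x (suc zero)    zero    zero    = Count-one _
counts-x (suc zero)    zero    (suc _) = Count-⊥ λ ()
counts-x (suc zero)    (suc _) _       = Count-⊥ λ ()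
counts-x (suc (suc _)) _       _       = Count-⊥ λ ()

counts-y : Yₛ counts monomial (0 , 1 , 0)
counts-y (suc _) _             _       = Count-⊥ λ ()
counts-y zero    zero          _       = Count-⊥ λ ()
counts-y zero    (suc zero)    zero    = Count-one _
counts-y zero    (suc zero)    (suc _) = Count-⊥ λ ()
counts-y zero    (suc (suc _)) _       = Count-⊥ λ ()

counts-q : Qₛ counts monomial (0 , 0 , 1)
counts-q (suc _) _       _             = Count-⊥ λ ()
counts-q zero    (suc _) _             = Count-⊥ λ ()
counts-q zero    zero    zero          = Count-⊥ λ ()
counts-q zero    zero    (suc zero)    = Count-one _
counts-q zero    zero    (suc (suc _)) = Count-⊥ λ ()

counts-yq : Yₛ *ₛ Qₛ counts monomial (0 , 1 , 1)
counts-yq = counts-≅ (mk↔ₛ′ (λ _ → tt) (λ _ → tt , tt) (λ _ → refl) (λ _ → refl) , λ _ → refl)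
  (counts-× counts-y counts-q)

finite-counts : ∀ {A s N} → s counts A → FiniteBelow N A
finite-counts p (a , b , c) _ = Count⇒Finite (p a b c)

abstract
  -- The coefficients are the cardinalities found by the finiteness proof. How they were found is
  -- irrelevant by `Count-unique`, so `gf-counts` is all that is kept of them.
  gf : ∀ A → (∀ N → FiniteBelow N A) → Series
  gf A fin a b c = + proj₁ (fin _ (a , b , c) ℕ.≤-refl)

  gf-counts : ∀ A fin → gf A fin counts A
  gf-counts A fin a b c = let n , i = fin _ (a , b , c) ℕ.≤-refl in n , i , refl

-- Recursive structure of contracted plabic forests

data Colour : Set where
  white black : Colour

opposite : Colour → Colour
opposite white = black
opposite black = white

-- At index true every non-root boundary vertex carries the forest in the gap
-- after it, at index false nothing, which gives single trees.
mutual
  data Fo : Bool → Set where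
    none : ∀ {b} → Fo b
    more : Fo true → Ro true → Fo true

  data Ro (b : Bool) : Set where
    lollipop : Colour → Ro b
    branch   : Bn b → Ro b

  data Bn (b : Bool) : Set where
    leaf  : Fo b → Bn b
    inner : ∀ c → Nd b c → Bn b

  data Nd (b : Bool) (c : Colour) : Set where
    _◂_ : Ch b c → Chs b c → Nd b c

  data Ch (b : Bool) (c : Colour) : Set where
    leaf : Fo b → Ch b c
    node : Nd b (opposite c) → Ch b c

  data Chs (b : Bool) (c : Colour) : Set where
    one  : Ch b c → Chs b c
    many : Nd b c → Chs b c

-- A vertex of degree d weighs q^{d-2} if white and (yq)^{d-2} if black, i.e. one
-- such factor for each child but the last.
unit : Colour → Weight
unit white = 0 , 0 , 1
unit black = 0 , 1 , 1

-- A boundary leaf of helicity h with its boundary vertex has doubled helicity (2h - 1) + 1, so k =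
-- h, and dimension 0.
lollipopWt : Colour → Weight
lollipopWt white = 0 , 1 , 0
lollipopWt black = 0 , 0 , 0

mutual
  wtFo : ∀ {b} → Fo b → Weight
  wtFo none       = 0 , 0 , 0
  wtFo (more f r) = (1 , 0 , 0) ⊕ wtFo f ⊕ wtRo r

  -- The x of the root b₁ is charged where the component is attached. The yq of a branch accounts
  -- for the leading 1 in both k and r.
  wtRo : ∀ {b} → Ro b → Weight
  wtRo (lollipop c) = lollipopWt c
  wtRo (branch x)   = (0 , 1 , 1) ⊕ wtBn x

  wtBn : ∀ {b} → Bn b → Weight
  wtBn (leaf f)    = (1 , 0 , 0) ⊕ wtFo f
  wtBn (inner c x) = wtNd x

  wtNd : ∀ {b c} → Nd b c → Weight
  wtNd {c = c} (x ◂ xs) = unit c ⊕ wtCh x ⊕ wtChs xs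

  wtCh : ∀ {b c} → Ch b c → Weight
  wtCh (leaf f) = (1 , 0 , 0) ⊕ wtFo f
  wtCh (node x) = wtNd x

  wtChs : ∀ {b c} → Chs b c → Weight
  wtChs (one x)  = wtCh x
  wtChs (many x) = wtNd x

FoC RoC BnC LeafC : Bool → Class
FoC b = class (Fo b) wtFo
RoC b = class (Ro b) wtRo
BnC b = class (Bn b) wtBn
LeafC b = monomial (1 , 0 , 0) ×ᶜ FoC b

NdC ChC ChsC : Bool → Colour → Class
NdC b c  = class (Nd b c) wtNd
ChC b c  = class (Ch b c) wtCh
ChsC b c = class (Chs b c) wtChs

Fo-false : monomial (0 , 0 , 0) ≅ FoC false
Fo-false = mk↔ₛ′ (λ _ → none) (λ _ → tt) (λ { none → refl }) (λ _ → refl) , λ _ → refl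

Fo-true : monomial (0 , 0 , 0) ⊎ᶜ monomial (1 , 0 , 0) ×ᶜ FoC true ×ᶜ RoC true ≅ FoC true
Fo-true = mk↔ₛ′ (λ { (inj₁ _) → none ; (inj₂ (_ , f , r)) → more f r })
                (λ { none → inj₁ tt ; (more f r) → inj₂ (tt , f , r) })
                (λ { none → refl ; (more _ _) → refl })
                (λ { (inj₁ _) → refl ; (inj₂ _) → refl })
        , λ { (inj₁ _) → refl ; (inj₂ _) → refl }

Ro-sum : ∀ b → (monomial (0 , 0 , 0) ⊎ᶜ monomial (0 , 1 , 0)) ⊎ᶜ monomial (0 , 1 , 1) ×ᶜ BnC b ≅ RoC b
Ro-sum b = mk↔ₛ′ (λ { (inj₁ (inj₁ _)) → lollipop black ; (inj₁ (inj₂ _)) → lollipop white ; (inj₂ (_ , x)) → branch x })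
                 (λ { (lollipop black) → inj₁ (inj₁ tt) ; (lollipop white) → inj₁ (inj₂ tt) ; (branch x) → inj₂ (tt , x) })
                 (λ { (lollipop black) → refl ; (lollipop white) → refl ; (branch _) → refl })
                 (λ { (inj₁ (inj₁ _)) → refl ; (inj₁ (inj₂ _)) → refl ; (inj₂ _) → refl })
         , λ { (inj₁ (inj₁ _)) → refl ; (inj₁ (inj₂ _)) → refl ; (inj₂ _) → refl }

Bn-sum : ∀ b → (LeafC b ⊎ᶜ NdC b white) ⊎ᶜ NdC b black ≅ BnC b
Bn-sum b = mk↔ₛ′ (λ { (inj₁ (inj₁ (_ , f))) → leaf f ; (inj₁ (inj₂ x)) → inner white x ; (inj₂ x) → inner black x })
                 (λ { (leaf f) → inj₁ (inj₁ (tt , f)) ; (inner white x) → inj₁ (inj₂ x) ; (inner black x) → inj₂ x })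
                 (λ { (leaf f) → refl ; (inner white x) → refl ; (inner black x) → refl })
                 (λ { (inj₁ (inj₁ _)) → refl ; (inj₁ (inj₂ _)) → refl ; (inj₂ _) → refl })
         , λ { (inj₁ (inj₁ _)) → refl ; (inj₁ (inj₂ _)) → refl ; (inj₂ _) → refl }

Nd-product : ∀ b c → monomial (unit c) ×ᶜ ChC b c ×ᶜ ChsC b c ≅ NdC b c
Nd-product b c = mk↔ₛ′ (λ (_ , x , xs) → x ◂ xs) (λ { (x ◂ xs) → tt , x , xs }) (λ { (_ ◂ _) → refl }) (λ { (_ , _ , _) → refl })
               , λ _ → refl

Ch-sum : ∀ b c → LeafC b ⊎ᶜ NdC b (opposite c) ≅ ChC b c
Ch-sum b c = mk↔ₛ′ (λ { (inj₁ (_ , f)) → leaf f ; (inj₂ x) → node x })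
                   (λ { (leaf f) → inj₁ (tt , f) ; (node x) → inj₂ x })
                   (λ { (leaf f) → refl ; (node x) → refl })
                   (λ { (inj₁ _) → refl ; (inj₂ _) → refl })
           , λ { (inj₁ _) → refl ; (inj₂ _) → refl }

Chs-sum : ∀ b c → ChC b c ⊎ᶜ NdC b c ≅ ChsC b c
Chs-sum b c = mk↔ₛ′ [ one , many ] (λ { (one x) → inj₁ x ; (many x) → inj₂ x })
                    (λ { (one x) → refl ; (many x) → refl })
                    (λ { (inj₁ _) → refl ; (inj₂ _) → refl })
            , λ { (inj₁ _) → refl ; (inj₂ _) → refl }

unitS : Colour → Series
unitS white = Qₛ
unitS black = Yₛ *ₛ Qₛ

counts-unit : ∀ c → unitS c counts monomial (unit c)
counts-unit white = counts-q
counts-unit black = counts-yq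

-- Finiteness, generating functions and their equations

record AllFinite (b : Bool) (N : ℕ) : Set where
  field
    fo  : FiniteBelow N (FoC b)
    ro  : FiniteBelow N (RoC b)
    bn  : FiniteBelow N (BnC b)
    nd  : ∀ c → FiniteBelow N (NdC b c)
    ch  : ∀ c → FiniteBelow N (ChC b c)
    chs : ∀ c → FiniteBelow N (ChsC b c)
open AllFinite

-- Boundary vertices, the units at a vertex, and the branch at b₁ cost one degree, so what follows
-- them is taken from level N. The sums `bn`, `ch` and `chs` cost nothing and are built from `nd` at
-- level N + 1.
allFinite : ∀ b N → AllFinite b N
allFinite b zero = record
  { fo = λ _ () ; ro = λ _ () ; bn = λ _ () ; nd = λ _ _ () ; ch = λ _ _ () ; chs = λ _ _ () }
allFinite b (suc N) = record { fo = foN b ih ; ro = roN ; bn = bnN ; nd = ndN ; ch = chN ; chs = chsN }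
  where
  ih = allFinite b N
  foN : ∀ b → AllFinite b N → FiniteBelow (suc N) (FoC b)
  foN false _  = finite-≅ Fo-false (finite-counts counts-1)
  foN true  ih = finite-≅ Fo-true (finite-⊎ (finite-counts counts-1)
    (finite-× 1 (λ _ → ℕ.≤-refl) (finite-counts counts-x) (finite-× 0 (λ _ → z≤n) (fo ih) (ro ih))))
  leafN : FiniteBelow (suc N) (LeafC b)
  leafN = finite-× 1 (λ _ → ℕ.≤-refl) (finite-counts counts-x) (fo ih)
  unit-deg : ∀ c → 1 ≤ deg (unit c)
  unit-deg white = ℕ.≤-refl
  unit-deg black = ℕ.≤-refl
  ndN : ∀ c → FiniteBelow (suc N) (NdC b c)
  ndN c = finite-≅ (Nd-product b c) (finite-× 1 (λ _ → unit-deg c) (finite-counts (counts-unit c))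
    (finite-× 0 (λ _ → z≤n) (ch ih c) (chs ih c)))
  bnN : FiniteBelow (suc N) (BnC b)
  bnN = finite-≅ (Bn-sum b) (finite-⊎ (finite-⊎ leafN (ndN white)) (ndN black))
  roN : FiniteBelow (suc N) (RoC b)
  roN = finite-≅ (Ro-sum b) (finite-⊎ (finite-⊎ (finite-counts counts-1) (finite-counts counts-y))
    (finite-× 1 (λ _ → ℕ.≤-refl) (finite-counts counts-yq) (bn ih)))
  chN : ∀ c → FiniteBelow (suc N) (ChC b c)
  chN c = finite-≅ (Ch-sum b c) (finite-⊎ leafN (ndN (opposite c)))
  chsN : ∀ c → FiniteBelow (suc N) (ChsC b c)
  chsN c = finite-≅ (Chs-sum b c) (finite-⊎ (chN c) (ndN c))

module _ (b : Bool) where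
  foS roS bnS leafS : Series
  foS = gf (FoC b) (λ N → fo (allFinite b N))
  roS = gf (RoC b) (λ N → ro (allFinite b N))
  bnS = gf (BnC b) (λ N → bn (allFinite b N))
  leafS = Xₛ *ₛ foS

  ndS chS chsS : Colour → Series
  ndS c  = gf (NdC b c) (λ N → nd (allFinite b N) c)
  chS c  = gf (ChC b c) (λ N → ch (allFinite b N) c)
  chsS c = gf (ChsC b c) (λ N → chs (allFinite b N) c)

  counts-fo : foS counts FoC b
  counts-fo = gf-counts (FoC b) (λ N → fo (allFinite b N))

  counts-ro : roS counts RoC b
  counts-ro = gf-counts (RoC b) (λ N → ro (allFinite b N))

  counts-bn : bnS counts BnC b
  counts-bn = gf-counts (BnC b) (λ N → bn (allFinite b N))

  counts-nd : ∀ c → ndS c counts NdC b c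
  counts-nd c = gf-counts (NdC b c) (λ N → nd (allFinite b N) c)

  counts-ch : ∀ c → chS c counts ChC b c
  counts-ch c = gf-counts (ChC b c) (λ N → ch (allFinite b N) c)

  counts-chs : ∀ c → chsS c counts ChsC b c
  counts-chs c = gf-counts (ChsC b c) (λ N → chs (allFinite b N) c)

  counts-leaf : leafS counts LeafC b
  counts-leaf = counts-× counts-x counts-fo

  ro-eq : roS ≈ₛ oneₛ +ₛ Yₛ +ₛ Yₛ *ₛ Qₛ *ₛ bnS
  ro-eq = counts-unique counts-ro (counts-≅ (Ro-sum b)
    (counts-⊎ (counts-⊎ counts-1 counts-y) (counts-× counts-yq counts-bn)))

  bn-eq : bnS ≈ₛ leafS +ₛ ndS white +ₛ ndS black
  bn-eq = counts-unique counts-bn (counts-≅ (Bn-sum b)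
    (counts-⊎ (counts-⊎ counts-leaf (counts-nd white)) (counts-nd black)))

  nd-eq : ∀ c → ndS c ≈ₛ unitS c *ₛ (chS c *ₛ chsS c)
  nd-eq c = counts-unique (counts-nd c) (counts-≅ (Nd-product b c)
    (counts-× (counts-unit c) (counts-× (counts-ch c) (counts-chs c))))

  ch-eq : ∀ c → chS c ≈ₛ leafS +ₛ ndS (opposite c)
  ch-eq c = counts-unique (counts-ch c) (counts-≅ (Ch-sum b c) (counts-⊎ counts-leaf (counts-nd (opposite c))))

  chs-eq : ∀ c → chsS c ≈ₛ chS c +ₛ ndS c
  chs-eq c = counts-unique (counts-chs c) (counts-≅ (Chs-sum b c) (counts-⊎ (counts-ch c) (counts-nd c)))

fo-eq-false : foS false ≈ₛ oneₛ
fo-eq-false = counts-unique (counts-fo false) (counts-≅ Fo-false counts-1)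

fo-eq-true : foS true ≈ₛ oneₛ +ₛ Xₛ *ₛ (foS true *ₛ roS true)
fo-eq-true = counts-unique (counts-fo true) (counts-≅ Fo-true
  (counts-⊎ counts-1 (counts-× counts-x (counts-× (counts-fo true) (counts-ro true)))))

module _ (b : Bool) where
  open SetoidReasoning 𝕊.setoid
  open Identities PSx.series using (swapʳ)

  -- One child not of colour c is a branch, and two or more form a vertex of colour c.
  chs≈bn : ∀ c → chsS b c ≈ₛ bnS b
  chs≈bn white = begin
    chsS b white                                ≈⟨ chs-eq b white ⟩
    chS b white +ₛ ndS b white                  ≈⟨ 𝕊.+-congʳ {ndS b white} (ch-eq b white) ⟩
    leafS b +ₛ ndS b black +ₛ ndS b white       ≈⟨ swapʳ (leafS b) (ndS b black) (ndS b white) ⟩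
    leafS b +ₛ ndS b white +ₛ ndS b black       ≈⟨ bn-eq b ⟨
    bnS b ∎
  chs≈bn black = begin
    chsS b black                                ≈⟨ chs-eq b black ⟩
    chS b black +ₛ ndS b black                  ≈⟨ 𝕊.+-congʳ {ndS b black} (ch-eq b black) ⟩
    leafS b +ₛ ndS b white +ₛ ndS b black       ≈⟨ bn-eq b ⟨
    bnS b ∎

  nd-product : ∀ c {u} → unitS c ≈ₛ u → ndS b c ≈ₛ u ✶ ((leafS b ⊹ ndS b (opposite c)) ✶ bnS b)
  nd-product c u = 𝕊.trans (nd-eq b c) (*ₛ-cong u (*ₛ-cong (ch-eq b c) (chs≈bn c)))

  branchEqₛ : BranchEqₛ (leafS b) (bnS b)
  branchEqₛ = BranchAlgebra.branchEq PSx.series (λ x y z p n → +-cancel-y (x n) (y n) (z n) (p n))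
    {Qₛ} {Yₛ} {leafS b} {ndS b white} {ndS b black} {bnS b}
    (bn-eq b) (nd-product white (𝕊.refl {Qₛ})) (nd-product black (*ₛ≈✶ Yₛ Qₛ))

  ro≈rootS : roS b ≈ₛ rootS (bnS b)
  ro≈rootS = 𝕊.trans (ro-eq b)
    (𝕊.+-cong (𝕊.+-congʳ {Yₛ} oneₛ≈𝟙) (*ₛ-cong (*ₛ≈✶ Yₛ Qₛ) (𝕊.refl {bnS b})))

module _ where
  open SetoidReasoning 𝕊.setoid
  private module 𝕊y = CommutativeSemiring PSy.series

  NoConstX-✶ : ∀ {f} → NoConstX f → ∀ g → NoConstX (f ✶ g)
  NoConstX-✶ {f} z g = 𝕊y.trans {f 0 PSy.✶ g 0} (𝕊y.*-congʳ {g 0} z) (𝕊y.zeroˡ (g 0))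

  NoConstX-≈ : ∀ {f g} → f ≈ₛ g → NoConstX g → NoConstX f
  NoConstX-≈ p z b c = trans (p 0 b c) (z b c)

  NoConstX-⊚ : ∀ {f} → NoConstX f → ∀ h → NoConstX (f ⊚ h)
  NoConstX-⊚ {f} z h = 𝕊y.trans {f 0 PSy.✶ pow h 0 0} (𝕊y.*-congʳ {pow h 0 0} z) (𝕊y.zeroˡ (pow h 0 0))

  NoConstX-Xₛ : NoConstX Xₛ
  NoConstX-Xₛ _ _ = refl

  X-cancel : ∀ {f g} → Xₛ ✶ f ≈ₛ Xₛ ✶ g → f ≈ₛ g
  X-cancel {f} {g} p n b c = trans (sym (shift f)) (trans (p (suc n) b c) (shift g))
    where
    shift : ∀ f → (Xₛ ✶ f) (suc n) b c ≡ f n b c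
    shift f = trans (𝕊.*-congʳ {f} Xₛ≈X (suc n) b c) (PSx.X-✶-suc f n b c)

  mutual
    1≤wtNd : ∀ {b c} (x : Nd b c) → 1 ≤ proj₁ (wtNd x)
    1≤wtNd {c = white} (x ◂ xs) = ℕ.≤-trans (1≤wtCh x) (ℕ.m≤m+n _ _)
    1≤wtNd {c = black} (x ◂ xs) = ℕ.≤-trans (1≤wtCh x) (ℕ.m≤m+n _ _)

    1≤wtCh : ∀ {b c} (x : Ch b c) → 1 ≤ proj₁ (wtCh x)
    1≤wtCh (leaf f) = s≤s z≤n
    1≤wtCh (node x) = 1≤wtNd x

  1≤wtBn : ∀ {b} (x : Bn b) → 1 ≤ proj₁ (wtBn x)
  1≤wtBn (leaf f)    = s≤s z≤n
  1≤wtBn (inner c x) = 1≤wtNd x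

  NoConstX-bnS : ∀ b → NoConstX (bnS b)
  NoConstX-bnS b k r = Count-unique (counts-bn b 0 k r)
    (Count-⊥ λ (x , e) → ℕ.<-irrefl (sym (cong proj₁ e)) (1≤wtBn x))

  leafS≈X : leafS false ≈ₛ Xₛ
  leafS≈X = 𝕊.trans (*ₛ-cong (𝕊.refl {Xₛ}) (𝕊.trans fo-eq-false oneₛ≈𝟙)) (𝕊.*-identityʳ Xₛ)

  NoConstX-leafS : ∀ b → NoConstX (leafS b)
  NoConstX-leafS b = NoConstX-≈ (*ₛ≈✶ Xₛ (foS b)) (NoConstX-✶ {Xₛ} NoConstX-Xₛ (foS b))

  forestEq-leafS : ForestEq (bnS true) (leafS true)
  forestEq-leafS = begin
    leafS true ≈⟨ *ₛ-cong (𝕊.refl {Xₛ}) fo-eq-true ⟩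
    Xₛ ✶ (oneₛ +ₛ Xₛ *ₛ (foS true *ₛ roS true))
      ≈⟨ 𝕊.*-congˡ {Xₛ} (𝕊.+-cong oneₛ≈𝟙 (*ₛ-cong (𝕊.refl {Xₛ}) (*ₛ≈✶ (foS true) (roS true)))) ⟩
    Xₛ ✶ (𝟙 ⊹ Xₛ ✶ (foS true ✶ roS true))
      ≈⟨ 𝕊.*-congˡ {Xₛ} (𝕊.+-congˡ {𝟙} (𝕊.*-assoc Xₛ (foS true) (roS true))) ⟨
    Xₛ ✶ (𝟙 ⊹ Xₛ ✶ foS true ✶ roS true)
      ≈⟨ 𝕊.*-congˡ {Xₛ} (𝕊.+-congˡ {𝟙} (𝕊.*-cong (𝕊.sym (*ₛ≈✶ Xₛ (foS true))) (ro≈rootS true))) ⟩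
    Xₛ ✶ (𝟙 ⊹ leafS true ✶ rootS (bnS true)) ∎

counts-cong : ∀ {A s t} → s ≈ₛ t → s counts A → t counts A
counts-cong {A} p q a b c = subst (Count (Fibre A (a , b , c))) (p a b c) (q a b c)

TreeC : Class
TreeC = monomial (1 , 0 , 0) ×ᶜ RoC false

-- Identification with the series of the theorem

module _ {C Cinv : Series} (isC : IsC C) (inv : IsCompInverse C Cinv) where

  Cinv₀ : NoConstX Cinv
  Cinv₀ = proj₁ (proj₂ inv)

  branchEq-Cinv : BranchEqₛ Xₛ Cinv
  branchEq-Cinv = BranchEq-cong {C ⊚ Cinv} {B = Xₛ ⊚ Cinv}
    (𝕊.trans (𝕊.sym (∘ₛ≈⊚ C Cinv)) (proj₁ (proj₂ (proj₂ inv)))) (X-⊚ₛ Cinv₀)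
    (BranchEq-⊚ {C} {Xₛ} Cinv₀ (IsC⇒BranchEq isC))

  bnS≈Cinv : bnS false ≈ₛ Cinv
  bnS≈Cinv = branch-unique NoConstX-Xₛ (NoConstX-bnS false) Cinv₀
    (BranchEq-cong leafS≈X (𝕊.refl {bnS false}) (branchEqₛ false)) branchEq-Cinv

  Ptree-counts : Ptree Cinv counts TreeC
  Ptree-counts = counts-cong
    (𝕊.trans (*ₛ-cong (𝕊.refl {Xₛ}) (ro≈rootS false)) (𝕊.sym (Ptree≈ (𝕊.sym bnS≈Cinv))))
    (counts-× counts-x (counts-ro false))

  -- The pairs (H, `Cinv`∘H) and (`leafS true`, `bnS true`) solve the same system. They agree by
  -- uniqueness, and cancelling x leaves the series of forests.
  Pforest-counts : ∀ {G H P} → G *ₛ (oneₛ +ₛ Ptree Cinv) ≈ₛ Xₛ → IsCompInverse G H → Xₛ *ₛ P ≈ₛ H →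
                   P counts FoC true
  Pforest-counts {G} {H} {P} Gφ (_ , H₀ , GH , _) XP = counts-cong
    (X-cancel (𝕊.trans (𝕊.sym (*ₛ≈✶ Xₛ (foS true)))
      (𝕊.trans leafS≈H (𝕊.trans (𝕊.sym XP) (*ₛ≈✶ Xₛ P)))))
    (counts-fo true)
    where
    leafS≈H : leafS true ≈ₛ H
    leafS≈H = forest-unique (NoConstX-bnS true) (NoConstX-⊚ {Cinv} Cinv₀ H) (NoConstX-leafS true) H₀
      (branchEqₛ true) (BranchEq-cong (X-⊚ₛ H₀) (𝕊.refl {Cinv ⊚ H}) (BranchEq-⊚ {Xₛ} {Cinv} H₀ branchEq-Cinv))
      forestEq-leafS (forestEq H₀ Gφ GH)

-- Comparison with the planar encoding

-- The argument is the number of children, which is the degree less one.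
helicity : Colour → ℕ → ℕ
helicity white n = 1
helicity black n = n

extra : ∀ {b c} → Chs b c → ℕ
extra (one _)         = 0
extra (many (_ ◂ xs)) = suc (extra xs)

mutual
  embFo : ∀ {b} → Fo b → Forest
  embFo none       = emptyF
  embFo (more f r) = grow (embFo f) (embRo r)

  embRo : ∀ {b} → Ro b → Br Forest
  embRo (lollipop white) = node 1 []
  embRo (lollipop black) = node 0 []
  embRo (branch x)       = embBn x

  embBn : ∀ {b} → Bn b → Br Forest
  embBn (leaf f)    = bdry (embFo f)
  embBn (inner c x) = embNd x

  embNd : ∀ {b c} → Nd b c → Br Forest
  embNd {c = c} (x ◂ xs) = node (helicity c (2 ℕ.+ extra xs)) (embCh x ∷ embChs xs)

  embCh : ∀ {b c} → Ch b c → Br Forest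
  embCh (leaf f) = bdry (embFo f)
  embCh (node x) = embNd x

  embChs : ∀ {b c} → Chs b c → List (Br Forest)
  embChs (one x)         = embCh x ∷ []
  embChs (many (x ◂ xs)) = embCh x ∷ embChs xs

embChs-nonempty : ∀ {b c} (xs : Chs b c) → embChs xs ≢ []
embChs-nonempty (one _)        ()
embChs-nonempty (many (_ ◂ _)) ()

bdry-injective : ∀ {A : Set} {f g : A} → bdry f ≡ bdry g → f ≡ g
bdry-injective refl = refl

node-injective : ∀ {A : Set} {h h′} {cs cs′ : List (Br A)} → node h cs ≡ node h′ cs′ → h ≡ h′ × cs ≡ cs′
node-injective refl = refl , refl

mutual
  embFo-injective : ∀ {b} {f g : Fo b} → embFo f ≡ embFo g → f ≡ g
  embFo-injective {f = none}     {none}     _ = refl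
  embFo-injective {f = more f r} {more g s} e =
    cong₂ more (embFo-injective (proj₁ (grow-injective e))) (embRo-injective (proj₂ (grow-injective e)))
    where
    grow-injective : ∀ {f g t u} → grow f t ≡ grow g u → f ≡ g × t ≡ u
    grow-injective refl = refl , refl

  embRo-injective : ∀ {b} {r s : Ro b} → embRo r ≡ embRo s → r ≡ s
  embRo-injective {r = lollipop white} {lollipop white} _ = refl
  embRo-injective {r = lollipop black} {lollipop black} _ = refl
  embRo-injective {r = branch x}       {branch y}       e = cong branch (embBn-injective e)
  embRo-injective {r = lollipop white} {lollipop black} ()
  embRo-injective {r = lollipop black} {lollipop white} ()
  embRo-injective {r = lollipop white} {branch (leaf _)} ()
  embRo-injective {r = lollipop white} {branch (inner _ (_ ◂ _))} ()
  embRo-injective {r = lollipop black} {branch (leaf _)} ()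
  embRo-injective {r = lollipop black} {branch (inner _ (_ ◂ _))} ()
  embRo-injective {r = branch (leaf _)}            {lollipop white} ()
  embRo-injective {r = branch (inner _ (_ ◂ _))}   {lollipop white} ()
  embRo-injective {r = branch (leaf _)}            {lollipop black} ()
  embRo-injective {r = branch (inner _ (_ ◂ _))}   {lollipop black} ()

  -- The colour can be read off the helicity: 1 for white, and at least 2 for black because a vertex
  -- has at least two children.
  embBn-injective : ∀ {b} {x y : Bn b} → embBn x ≡ embBn y → x ≡ y
  embBn-injective {x = leaf f} {leaf g} e = cong leaf (embFo-injective (bdry-injective e))
  embBn-injective {x = leaf _} {inner _ (_ ◂ _)} ()
  embBn-injective {x = inner _ (_ ◂ _)} {leaf _} ()
  embBn-injective {x = inner white x} {inner white y} e = cong (inner white) (embNd-injective e)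
  embBn-injective {x = inner black x} {inner black y} e = cong (inner black) (embNd-injective e)
  embBn-injective {x = inner white (_ ◂ _)} {inner black (_ ◂ _)} ()
  embBn-injective {x = inner black (_ ◂ _)} {inner white (_ ◂ _)} ()

  embNd-injective : ∀ {b c} {x y : Nd b c} → embNd x ≡ embNd y → x ≡ y
  embNd-injective {x = x ◂ xs} {y ◂ ys} e with ∷-injective (proj₂ (node-injective e))
  ... | p , q = cong₂ _◂_ (embCh-injective p) (embChs-injective q)

  embCh-injective : ∀ {b c} {x y : Ch b c} → embCh x ≡ embCh y → x ≡ y
  embCh-injective {x = leaf f} {leaf g} e = cong leaf (embFo-injective (bdry-injective e))
  embCh-injective {x = node x} {node y} e = cong node (embNd-injective e)
  embCh-injective {x = leaf _} {node (_ ◂ _)} ()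
  embCh-injective {x = node (_ ◂ _)} {leaf _} ()

  embChs-injective : ∀ {b c} {xs ys : Chs b c} → embChs xs ≡ embChs ys → xs ≡ ys
  embChs-injective {xs = one x} {one y} e = cong one (embCh-injective (proj₁ (∷-injective e)))
  embChs-injective {xs = one x} {many (y ◂ ys)} e = ⊥-elim (embChs-nonempty ys (sym (proj₂ (∷-injective e))))
  embChs-injective {xs = many (x ◂ xs)} {one y} e = ⊥-elim (embChs-nonempty xs (proj₂ (∷-injective e)))
  embChs-injective {xs = many (x ◂ xs)} {many (y ◂ ys)} e with ∷-injective e
  ... | p , q = cong many (cong₂ _◂_ (embCh-injective p) (embChs-injective q))

-- The image of the encoding: contracted plabic forests

∧-split : ∀ {a b} → a ∧ b ≡ true → a ≡ true × b ≡ true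
∧-split {true} {true} _ = refl , refl

∧-join : ∀ {a b} → a ≡ true → b ≡ true → a ∧ b ≡ true
∧-join refl refl = refl

allB-++ : ∀ {X : Set} (p : X → Bool) xs {ys} → allB p xs ≡ true → allB p ys ≡ true → allB p (xs ++ ys) ≡ true
allB-++ p []       _ q = q
allB-++ p (x ∷ xs) e q = let e₁ , e₂ = ∧-split e in ∧-join e₁ (allB-++ p xs e₂ q)

allB-++⁻ : ∀ {X : Set} (p : X → Bool) xs {ys} → allB p (xs ++ ys) ≡ true → allB p xs ≡ true × allB p ys ≡ true
allB-++⁻ p []       e = refl , e
allB-++⁻ p (x ∷ xs) e = let e₁ , e₂ = ∧-split e ; f₁ , f₂ = allB-++⁻ p xs e₂ in ∧-join e₁ f₁ , f₂

≡ᵇ-refl : ∀ n → (n ≡ᵇ n) ≡ true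
≡ᵇ-refl zero    = refl
≡ᵇ-refl (suc n) = ≡ᵇ-refl n

≡ᵇ⇒≡ : ∀ m n → (m ≡ᵇ n) ≡ true → m ≡ n
≡ᵇ⇒≡ zero    zero    _ = refl
≡ᵇ⇒≡ (suc m) (suc n) e = cong suc (≡ᵇ⇒≡ m n e)

<ᵇ-suc : ∀ n → (n ℕ.<ᵇ suc n) ≡ true
<ᵇ-suc zero    = refl
<ᵇ-suc (suc n) = <ᵇ-suc n

nonGeneric : ℕ × ℕ → Bool
nonGeneric v = not (isGeneric v)

-- Goodness of the decorations; at index false there are none.
Deco : Bool → List Tree → Set
Deco b L = (allB isContractedPlabicTree L ≡ true) × (b ≡ false → L ≡ [])

-- `isContractedPlabicTree` runs each test over a whole tree and treats the root apart. Kept as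
-- separate fields, the tests restrict to subtrees, where no boundary leaf can occur.
record Good (b : Bool) (t : Br Forest) : Set where
  constructor good
  field
    grass : grassInner (strip t) ≡ true
    bicol : allB nonGeneric (verts (strip t)) ≡ true
    contd : contr (strip t) ≡ true
    deco  : Deco b (compsBr t)

record GoodL (b : Bool) (cs : List (Br Forest)) : Set where
  constructor goodL
  field
    grass : grassL (stripL cs) ≡ true
    bicol : allB nonGeneric (vertsL (stripL cs)) ≡ true
    contd : contrL (stripL cs) ≡ true
    deco  : Deco b (compsL cs)

Deco-++ : ∀ {b} L {M} → Deco b L → Deco b M → Deco b (L ++ M)
Deco-++ L {M} (p , p′) (q , q′) = allB-++ isContractedPlabicTree L p q , λ e → trans (cong (_++ M) (p′ e)) (q′ e)

Deco-++⁻ : ∀ {b} L {M} → Deco b (L ++ M) → Deco b L × Deco b M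
Deco-++⁻ L {M} (p , n) = let q , r = allB-++⁻ isContractedPlabicTree L p in
  (q , λ e → ++-conicalˡ L M (n e)) , (r , λ e → ++-conicalʳ L M (n e))

GoodL-∷ : ∀ {b t cs} → Good b t → GoodL b cs → GoodL b (t ∷ cs)
GoodL-∷ {t = t} (good a b c d) (goodL a′ b′ c′ d′) =
  goodL (∧-join a a′) (allB-++ nonGeneric (verts (strip t)) b b′) (∧-join c c′) (Deco-++ (compsBr t) d d′)

GoodL-∷⁻ : ∀ {b t cs} → GoodL b (t ∷ cs) → Good b t × GoodL b cs
GoodL-∷⁻ {t = t} (goodL a b c d) =
  let a₁ , a₂ = ∧-split a ; b₁ , b₂ = allB-++⁻ nonGeneric (verts (strip t)) b
      c₁ , c₂ = ∧-split c ; d₁ , d₂ = Deco-++⁻ (compsBr t) d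
  in good a₁ b₁ c₁ d₁ , goodL a₂ b₂ c₂ d₂

GoodL-[] : ∀ {b} → GoodL b []
GoodL-[] = goodL refl refl refl (refl , λ _ → refl)

vertex : Colour → ℕ → ℕ × ℕ
vertex c k = helicity c (2 ℕ.+ k) , 3 ℕ.+ k

length-embChs : ∀ {b c} (xs : Chs b c) → length (stripL (embChs xs)) ≡ suc (extra xs)
length-embChs (one x)         = refl
length-embChs (many (x ◂ xs)) = cong suc (length-embChs xs)

vertex-ok : ∀ c k → (okInner (proj₁ (vertex c k)) (3 ℕ.+ k) ≡ true) × (nonGeneric (vertex c k) ≡ true)
vertex-ok white k = refl , refl
vertex-ok black k = <ᵇ-suc k , cong (λ z → not (not z)) (≡ᵇ-refl k)

-- Degree at least 3 matters: at degree 2 helicity 1 would be white and black at once.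
vertex-alternates : ∀ c k l → clash (vertex c k) (vertex (opposite c) l) ≡ false
vertex-alternates white k l = refl
vertex-alternates black k l = Bool.∧-zeroʳ (k ≡ᵇ k)

black-clash : ∀ k l → clash (vertex black k) (vertex black l) ≡ true
black-clash k l = ∧-join (≡ᵇ-refl k) (≡ᵇ-refl l)

noClash-∷ : ∀ {b c} k (x : Ch b c) {cs} → noClash (vertex c k) cs ≡ true →
            noClash (vertex c k) (strip (embCh x) ∷ cs) ≡ true
noClash-∷ k (leaf f) e = e
noClash-∷ {c = c} k (node (y ◂ ys)) e rewrite length-embChs ys | vertex-alternates c k (extra ys) = e

noClash-embChs : ∀ {b c} k (xs : Chs b c) → noClash (vertex c k) (stripL (embChs xs)) ≡ true
noClash-embChs k (one x)         = noClash-∷ k x refl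
noClash-embChs k (many (x ◂ xs)) = noClash-∷ k x (noClash-embChs k xs)

mutual
  goodFo : ∀ {b} (f : Fo b) → Deco b (comps (embFo f))
  goodFo none       = refl , λ _ → refl
  goodFo (more f r) = let p , q = goodRo r in
    proj₁ (Deco-++ {true} (strip (embRo r) ∷ []) (∧-join p refl , λ ()) (Deco-++ (comps (embFo f)) (goodFo f) q)) , λ ()

  goodRo : ∀ {b} (r : Ro b) → (isContractedPlabicTree (strip (embRo r)) ≡ true) × Deco b (compsBr (embRo r))
  goodRo (lollipop white) = refl , refl , λ _ → refl
  goodRo (lollipop black) = refl , refl , λ _ → refl
  goodRo (branch (leaf f)) = refl , goodFo f
  goodRo (branch (inner c x@(_ ◂ _))) with goodNd x
  ... | good g n k d = ∧-join (∧-join g n) k , d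

  goodNd : ∀ {b c} (x : Nd b c) → Good b (embNd x)
  goodNd {c = c} (x ◂ xs) with GoodL-∷ (goodCh x) (goodChs xs) | vertex-ok c (extra xs)
  ... | goodL g n k d | ok , bi = good
    (∧-join (trans (cong (λ l → okInner (helicity c (2 ℕ.+ extra xs)) (2 ℕ.+ l)) (length-embChs xs)) ok) g)
    (∧-join (trans (cong (λ l → nonGeneric (helicity c (2 ℕ.+ extra xs) , 2 ℕ.+ l)) (length-embChs xs)) bi) n)
    (∧-join (trans (cong (λ l → noClash (helicity c (2 ℕ.+ extra xs) , 2 ℕ.+ l) (strip (embCh x) ∷ stripL (embChs xs)))
                         (length-embChs xs))
                   (noClash-∷ (extra xs) x (noClash-embChs (extra xs) xs))) k)
    d

  goodCh : ∀ {b c} (x : Ch b c) → Good b (embCh x)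
  goodCh (leaf f) = good refl refl refl (goodFo f)
  goodCh (node x) = goodNd x

  goodChs : ∀ {b c} (xs : Chs b c) → GoodL b (embChs xs)
  goodChs (one x)         = GoodL-∷ (goodCh x) GoodL-[]
  goodChs (many (x ◂ xs)) = GoodL-∷ (goodCh x) (goodChs xs)

Preimage : {A B : Set} → (A → B) → B → Set
Preimage {A} f y = Σ A λ x → f x ≡ y

colour-of : ∀ h k → nonGeneric (h , 3 ℕ.+ k) ≡ true → Σ Colour λ c → vertex c k ≡ (h , 3 ℕ.+ k)
colour-of h k e with h ≡ᵇ 1 in w | h ≡ᵇ (2 ℕ.+ k) in bl
... | true  | _    = white , cong (_, 3 ℕ.+ k) (sym (≡ᵇ⇒≡ h 1 w))
... | false | true = black , cong (_, 3 ℕ.+ k) (sym (≡ᵇ⇒≡ h (2 ℕ.+ k) bl))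

toCh : ∀ {b} c k (x : Bn b) → noClash (vertex c k) (strip (embBn x) ∷ []) ≡ true → Preimage (embCh {b} {c}) (embBn x)
toCh c     k (leaf f)    _ = leaf f , refl
toCh white k (inner black x) _ = node x , refl
toCh black k (inner white x) _ = node x , refl
toCh white k (inner white (_ ◂ _))  ()
toCh black k (inner black (_ ◂ ys)) e rewrite length-embChs ys | black-clash k (extra ys) with () ← e

noClash-∷⁻ : ∀ u (t : Tree) {cs} → noClash u (t ∷ cs) ≡ true → (noClash u (t ∷ []) ≡ true) × (noClash u cs ≡ true)
noClash-∷⁻ u (bdry _)   e = refl , e
noClash-∷⁻ u (node _ _) e = let p , q = ∧-split e in ∧-join p refl , q

mutual
  surjFo : ∀ {b} f → Deco b (comps f) → Preimage (embFo {b}) f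
  surjFo {b}     emptyF     _       = none , refl
  surjFo {false} (grow f t) (_ , n) with n refl
  ... | ()
  surjFo {true}  (grow f t) (d , n) =
    let d₁ , d₂ = ∧-split d ; e₁ , e₂ = allB-++⁻ isContractedPlabicTree (comps f) d₂
        g , p = surjFo {true} f (e₁ , λ ()) ; r , q = surjRo {true} t d₁ (e₂ , λ ())
    in more g r , cong₂ grow p q

  surjRo : ∀ {b} t → isContractedPlabicTree (strip t) ≡ true → Deco b (compsBr t) → Preimage (embRo {b}) t
  surjRo (bdry f) _ d = let g , p = surjFo f d in branch (leaf g) , cong bdry p
  surjRo (node zero          []) _ d = lollipop black , refl
  surjRo (node (suc zero)    []) _ d = lollipop white , refl
  surjRo (node (suc (suc _)) []) () d
  surjRo t@(node h cs@(_ ∷ _)) e d =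
    let e₁ , k = ∧-split e ; g , n = ∧-split e₁ ; x , p = surjNode h cs (good g n k d) in branch x , p

  surjBn : ∀ {b} t → Good b t → Preimage (embBn {b}) t
  surjBn (bdry f)    (good _ _ _ d) = let g , p = surjFo f d in leaf g , cong bdry p
  surjBn (node h cs) g              = surjNode h cs g

  surjNode : ∀ {b} h cs → Good b (node h cs) → Preimage (embBn {b}) (node h cs)
  surjNode zero    []           (good () _ _ _)
  surjNode (suc h) []           (good () _ _ _)
  surjNode h       (_ ∷ [])     (good () _ _ _)
  surjNode h       (s ∷ t ∷ ts) (good g n k d) with
    colour-of h (length (stripL ts)) (proj₁ (∧-split n))
  ... | c , refl =
    let k₁ , k₂ = ∧-split k
        gs , gr = GoodL-∷⁻ {t = s} (goodL (proj₂ (∧-split {okInner (helicity c (2 ℕ.+ length (stripL ts))) (3 ℕ.+ length (stripL ts))} g)) (proj₂ (∧-split n)) k₂ d)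
        n₁ , n₂ = noClash-∷⁻ (vertex c (length (stripL ts))) (strip s) k₁
        x , p   = surjCh c (length (stripL ts)) s gs n₁
        xs , q  = surjChs c (length (stripL ts)) t ts gr n₂
        -- `embNd` computes the helicity from `xs`, so the length of the rebuilt list must be
        -- matched with that of the given one before a black vertex is recovered.
        extra≡  = ℕ.suc-injective (trans (sym (length-embChs xs)) (cong (λ l → length (stripL l)) q))
    in inner c (x ◂ xs) , cong₂ node (cong (λ l → helicity c (2 ℕ.+ l)) extra≡) (cong₂ _∷_ p q)

  surjCh : ∀ {b} c k t → Good b t → noClash (vertex c k) (strip t ∷ []) ≡ true → Preimage (embCh {b} {c}) t
  surjCh c k t g n with surjBn t g
  ... | x , refl = toCh c k x n

  surjChs : ∀ {b} c k t ts → GoodL b (t ∷ ts) → noClash (vertex c k) (stripL (t ∷ ts)) ≡ true →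
            Preimage (embChs {b} {c}) (t ∷ ts)
  surjChs c k t [] g n =
    let x , p = surjCh c k t (proj₁ (GoodL-∷⁻ g)) n in one x , cong (_∷ []) p
  surjChs c k t (u ∷ us) g n =
    let gt , gu = GoodL-∷⁻ {t = t} g ; n₁ , n₂ = noClash-∷⁻ (vertex c k) (strip t) n
        x , p = surjCh c k t gt n₁ ; xs , q = surjChs c k u us gu n₂
    in many (x ◂ xs) , cong₂ _∷_ p q

-- Size, helicity and dimension of encoded forests

sumOver : {A : Set} → (A → ℤ) → List A → ℤ
sumOver f xs = sumℤ (mapL f xs)

sumOver-++ : ∀ {A : Set} (f : A → ℤ) xs ys → sumOver f (xs ++ ys) ≡ sumOver f xs + sumOver f ys
sumOver-++ f []       ys = sym (ℤ.+-identityˡ _)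
sumOver-++ f (x ∷ xs) ys = trans (cong (_+_ (f x)) (sumOver-++ f xs ys)) (sym (ℤ.+-assoc (f x) _ _))

treeNℤ : Tree → ℤ
treeNℤ t = + treeN t

dimTerm : ℕ × ℕ → ℤ
dimTerm v = mv v - + 1

-- The statistics of a list of ℓ branches below a vertex, the last three
-- being the totals over the trees that decorate it; δ is the value of
-- hel2v at that vertex, so that grafting the branches onto it gives δ = 0.
record Fits (δ ℓ n h v sn sh sd : ℤ) (w : Weight) : Set where
  constructor fits
  field
    size-eq : n + sn ≡ + proj₁ w
    hel-eq  : h + n + sh + δ ≡ + 2 * + proj₁ (proj₂ w) + + 1
    vol-eq  : v + ℓ ≡ n
    dim-eq  : n + sd ≡ + proj₂ (proj₂ w) + + 1

FitsBr : Br Forest → Weight → Set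
FitsBr t = Fits (+ 0) (+ 1) (+ nb (strip t)) (sumOver hel2v (verts (strip t))) (sumOver dimTerm (verts (strip t)))
  (sumOver treeNℤ (compsBr t)) (sumOver hel2Tree (compsBr t)) (sumOver dimTree (compsBr t))

FitsL : ℤ → ℤ → List (Br Forest) → Weight → Set
FitsL δ ℓ cs = Fits δ ℓ (+ nbL (stripL cs)) (sumOver hel2v (vertsL (stripL cs))) (sumOver dimTerm (vertsL (stripL cs)))
  (sumOver treeNℤ (compsL cs)) (sumOver hel2Tree (compsL cs)) (sumOver dimTree (compsL cs))

-- The change in 2h - deg when a vertex gains a child: this quantity is 2 - deg for white and deg -
-- 2 for black.
step : Colour → ℤ
step white = ℤ.- (+ 1)
step black = + 1

-- Adding the equations leaves a surplus of 1 in helicity and in dimension, which `unit c` absorbs.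
-- In dimension it is the new q; in doubled helicity it combines with `step c` to 0 for white and 2
-- for black, which is the new y.
fits-+ : ∀ c {δ ℓ n h v sn sh sd w n′ h′ v′ sn′ sh′ sd′ w′} →
         Fits (+ 0) (+ 1) n h v sn sh sd w → Fits δ ℓ n′ h′ v′ sn′ sh′ sd′ w′ →
         Fits (δ + step c) (+ 1 + ℓ) (n + n′) (h + h′) (v + v′) (sn + sn′) (sh + sh′) (sd + sd′) (unit c ⊕ w ⊕ w′)
fits-+ c {δ} {ℓ} {n} {h} {v} {sn} {sh} {sd} {w} {n′} {h′} {v′} {sn′} {sh′} {sd′} {w′} (fits a b e d) (fits a′ b′ e′ d′) = fits
  (trans (swap n n′ sn sn′) (trans (cong₂ _+_ a a′) (sizes c)))
  (trans (hels h h′ n n′ sh sh′ δ (step c)) (trans (cong₂ (λ x y → x + y + step c) b b′) (heights c)))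
  (trans (vols v v′ ℓ) (cong₂ _+_ e e′))
  (trans (swap n n′ sd sd′) (trans (cong₂ _+_ d d′) (dims c)))
  where
  swap : ∀ a b c d → (a + b) + (c + d) ≡ (a + c) + (b + d)
  swap = solve-∀
  hels : ∀ h h′ n n′ s s′ δ ε → (h + h′) + (n + n′) + (s + s′) + (δ + ε) ≡ (h + n + s + + 0) + (h′ + n′ + s′ + δ) + ε
  hels = solve-∀
  vols : ∀ v v′ ℓ → (v + v′) + (+ 1 + ℓ) ≡ (v + + 1) + (v′ + ℓ)
  vols = solve-∀
  sizes : ∀ c → + proj₁ w + + proj₁ w′ ≡ + proj₁ (unit c ⊕ w ⊕ w′)
  sizes white = refl
  sizes black = refl
  heights : ∀ c → (+ 2 * + proj₁ (proj₂ w) + + 1) + (+ 2 * + proj₁ (proj₂ w′) + + 1) + step c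
            ≡ + 2 * + proj₁ (proj₂ (unit c ⊕ w ⊕ w′)) + + 1
  heights white = lemma (+ proj₁ (proj₂ w)) (+ proj₁ (proj₂ w′))
    where
    lemma : ∀ k l → (+ 2 * k + + 1) + (+ 2 * l + + 1) + ℤ.- (+ 1) ≡ + 2 * (k + l) + + 1
    lemma = solve-∀
  heights black = lemma (+ proj₁ (proj₂ w)) (+ proj₁ (proj₂ w′))
    where
    lemma : ∀ k l → (+ 2 * k + + 1) + (+ 2 * l + + 1) + + 1 ≡ + 2 * (+ 1 + (k + l)) + + 1
    lemma = solve-∀
  dims : ∀ c → (+ proj₂ (proj₂ w) + + 1) + (+ proj₂ (proj₂ w′) + + 1) ≡ + proj₂ (proj₂ (unit c ⊕ w ⊕ w′)) + + 1
  dims c = trans (lemma (+ proj₂ (proj₂ w)) (+ proj₂ (proj₂ w′))) (last c)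
    where
    lemma : ∀ k l → (k + + 1) + (l + + 1) ≡ (+ 1 + (k + l)) + + 1
    lemma = solve-∀
    last : ∀ c → (+ 1 + (+ proj₂ (proj₂ w) + + proj₂ (proj₂ w′))) + + 1 ≡ + proj₂ (proj₂ (unit c ⊕ w ⊕ w′)) + + 1
    last white = refl
    last black = refl

fits-∷ : ∀ c {δ ℓ} t cs {w w′} → FitsBr t w → FitsL δ ℓ cs w′ → FitsL (δ + step c) (+ 1 + ℓ) (t ∷ cs) (unit c ⊕ w ⊕ w′)
fits-∷ c t cs p q
  rewrite sumOver-++ hel2v (verts (strip t)) (vertsL (stripL cs))
        | sumOver-++ dimTerm (verts (strip t)) (vertsL (stripL cs))
        | sumOver-++ treeNℤ (compsBr t) (compsL cs)
        | sumOver-++ hel2Tree (compsBr t) (compsL cs)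
        | sumOver-++ dimTree (compsBr t) (compsL cs)
  = fits-+ c p q

fits-one : ∀ t {w} → FitsBr t w → FitsL (+ 0) (+ 1) (t ∷ []) w
fits-one t p
  rewrite sumOver-++ hel2v (verts (strip t)) []
        | sumOver-++ dimTerm (verts (strip t)) []
        | sumOver-++ treeNℤ (compsBr t) []
        | sumOver-++ hel2Tree (compsBr t) []
        | sumOver-++ dimTree (compsBr t) []
        | ℕ.+-identityʳ (nb (strip t))
        | ℤ.+-identityʳ (sumOver hel2v (verts (strip t)))
        | ℤ.+-identityʳ (sumOver dimTerm (verts (strip t)))
        | ℤ.+-identityʳ (sumOver treeNℤ (compsBr t))
        | ℤ.+-identityʳ (sumOver hel2Tree (compsBr t))
        | ℤ.+-identityʳ (sumOver dimTree (compsBr t))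
  = p

-- hel2v of a vertex of the given colour with m + 1 children, also for m = 0.
tilt : Colour → ℕ → ℤ
tilt c m = hel2v (helicity c (suc m) , 2 ℕ.+ m)

tilt-suc : ∀ c m → tilt c m + step c ≡ tilt c (suc m)
tilt-suc white m = lemma (+ m)
  where
  lemma : ∀ m → (+ 2 * + 1 - (+ 2 + m)) + ℤ.- (+ 1) ≡ + 2 * + 1 - (+ 3 + m)
  lemma = solve-∀
tilt-suc black m = lemma (+ m)
  where
  lemma : ∀ m → (+ 2 * (+ 1 + m) - (+ 2 + m)) + + 1 ≡ + 2 * (+ 2 + m) - (+ 3 + m)
  lemma = solve-∀

tilt-zero : ∀ c → tilt c 0 ≡ + 0
tilt-zero white = refl
tilt-zero black = refl

mv-vertex : ∀ c k → mv (vertex c k) ≡ + (3 ℕ.+ k) - + 1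
mv-vertex white k = refl
mv-vertex black k rewrite ≡ᵇ-refl k = refl

-- The defect d becomes the helicity term of the new vertex. Its dimension term 1 + k together with
-- the single resulting branch replaces the 2 + k branches.
fits-graft : ∀ {d k h v n sn sh sd w} → Fits d (+ (2 ℕ.+ k)) n h v sn sh sd w →
             Fits (+ 0) (+ 1) n (d + h) ((+ (3 ℕ.+ k) - + 1 - + 1) + v) sn sh sd w
fits-graft {d} {k} {h} {v} {n} {sh = sh} (fits a b e f) = fits a
  (trans (hels d h n sh) b) (trans (vols (+ k) v) e) f
  where
  hels : ∀ d h n s → (d + h) + n + s + + 0 ≡ h + n + s + d
  hels = solve-∀
  vols : ∀ k v → ((+ 3 + k) - + 1 - + 1) + v + + 1 ≡ v + (+ 2 + k)
  vols = solve-∀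

StatsF : List Tree → Weight → Set
StatsF L (a , k , r) = (sumOver treeNℤ L ≡ + a) × (sumOver hel2Tree L ≡ + 2 * + k) × (sumOver dimTree L ≡ + r)

1≤nb : ∀ {b c} (x : Ch b c) → 1 ≤ nb (strip (embCh x))
1≤nb (leaf f)        = ℕ.≤-refl
1≤nb (node (x ◂ xs)) = ℕ.≤-trans (1≤nb x) (ℕ.m≤m+n _ _)

2≤nb : ∀ {b c} (x : Nd b c) → 2 ≤ nb (strip (embNd x))
2≤nb (x ◂ xs) = ℕ.+-mono-≤ (1≤nb x) (1≤nbL xs)
  where
  1≤nbL : ∀ {b c} (xs : Chs b c) → 1 ≤ nbL (stripL (embChs xs))
  1≤nbL (one x)         = ℕ.≤-trans (1≤nb x) (ℕ.m≤m+n _ _)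
  1≤nbL (many (x ◂ xs)) = ℕ.≤-trans (1≤nb x) (ℕ.m≤m+n _ _)

-- The bound selects the case n > 2 of `dimTree`. The value n - 1 found there continues the formula
-- of the small cases.
dimTree≡nb : ∀ t → 2 ≤ nb t → sumOver dimTerm (verts t) + + 1 ≡ + nb t → dimTree t ≡ + nb t
dimTree≡nb t p e with nb t | p
... | suc (suc m) | s≤s (s≤s z≤n) = trans (ℤ.+-comm (+ 1) (sumOver dimTerm (verts t))) e

mutual
  fitsNd : ∀ {b c} (x : Nd b c) → FitsBr (embNd x) (wtNd x)
  fitsNd {c = c} (x ◂ xs) rewrite length-embChs xs | mv-vertex c (extra xs) =
    fits-graft {k = extra xs} (subst (λ d → FitsL d (+ (2 ℕ.+ extra xs)) (embCh x ∷ embChs xs) (unit c ⊕ wtCh x ⊕ wtChs xs))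
      (tilt-suc c (extra xs)) (fits-∷ c (embCh x) (embChs xs) (fitsCh x) (fitsChs xs)))

  fitsLeaf : ∀ {b} (f : Fo b) → FitsBr (bdry (embFo f)) ((1 , 0 , 0) ⊕ wtFo f)
  fitsLeaf f with statsFo f
  ... | p , q , r = fits (cong (_+_ (+ 1)) p)
    (trans (lemma (sumOver hel2Tree (comps (embFo f)))) (cong (_+ + 1) q)) refl
    (trans (cong (_+_ (+ 1)) r) (ℤ.+-comm (+ 1) (+ proj₂ (proj₂ (wtFo f)))))
    where
    lemma : ∀ h → + 0 + + 1 + h + + 0 ≡ h + + 1
    lemma = solve-∀

  fitsCh : ∀ {b c} (x : Ch b c) → FitsBr (embCh x) (wtCh x)
  fitsCh (leaf f) = fitsLeaf f
  fitsCh (node x) = fitsNd x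

  fitsChs : ∀ {b c} (xs : Chs b c) → FitsL (tilt c (extra xs)) (+ suc (extra xs)) (embChs xs) (wtChs xs)
  fitsChs {c = c} (one x) rewrite tilt-zero c = fits-one (embCh x) (fitsCh x)
  fitsChs {c = c} (many (x ◂ xs)) =
    subst (λ d → FitsL d (+ (2 ℕ.+ extra xs)) (embCh x ∷ embChs xs) (unit c ⊕ wtCh x ⊕ wtChs xs))
      (tilt-suc c (extra xs)) (fits-∷ c (embCh x) (embChs xs) (fitsCh x) (fitsChs xs))

  fitsBn : ∀ {b} (x : Bn b) → FitsBr (embBn x) (wtBn x) × (dimTree (strip (embBn x)) ≡ + nb (strip (embBn x)))
  fitsBn (leaf f)    = fitsLeaf f , refl
  fitsBn (inner c x) = fitsNd x , dimTree≡nb (strip (embNd x)) (2≤nb x) (Fits.vol-eq (fitsNd x))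

  -- For a branch, b₁ contributes 1 to the doubled helicity and turns the odd 2k + 1 into 2(1 + k);
  -- this is the y of `branch`, and the constant of `dim-eq` is its q.
  statsRo : ∀ {b} (r : Ro b) → StatsF (strip (embRo r) ∷ compsBr (embRo r)) ((1 , 0 , 0) ⊕ wtRo r)
  statsRo (lollipop white) = refl , refl , refl
  statsRo (lollipop black) = refl , refl , refl
  statsRo (branch x) with fitsBn x
  ... | fits a b e d , dim =
    trans (size (+ nb t) (sumOver treeNℤ L)) (cong (_+_ (+ 1)) a) ,
    trans (hel (sumOver hel2v (verts t)) (+ nb t) (sumOver hel2Tree L))
      (trans (cong (_+ + 1) b) (double (+ proj₁ (proj₂ (wtBn x))))) ,
    trans (cong (_+ sumOver dimTree L) dim) (trans d (ℤ.+-comm (+ proj₂ (proj₂ (wtBn x))) (+ 1)))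
    where
    t = strip (embBn x)
    L = compsBr (embBn x)
    size : ∀ n s → (+ 1 + n) + s ≡ + 1 + (n + s)
    size = solve-∀
    hel : ∀ h n s → (h + (+ 1 + n)) + s ≡ (h + n + s + + 0) + + 1
    hel = solve-∀
    double : ∀ k → (+ 2 * k + + 1) + + 1 ≡ + 2 * (+ 1 + k)
    double = solve-∀

  statsFo : ∀ {b} (f : Fo b) → StatsF (comps (embFo f)) (wtFo f)
  statsFo none = refl , refl , refl
  statsFo (more f r) with statsFo f | statsRo r
  ... | p , q , s | p′ , q′ , s′ =
    trans (split treeNℤ) (trans (cong₂ _+_ p p′) (swap (+ proj₁ (wtFo f)) (+ proj₁ (wtRo r)))) ,
    trans (split hel2Tree) (trans (cong₂ _+_ q q′) (sym (ℤ.*-distribˡ-+ (+ 2) (+ proj₁ (proj₂ (wtFo f))) (+ proj₁ (proj₂ (wtRo r)))))) ,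
    trans (split dimTree) (cong₂ _+_ s s′)
    where
    rotate′ : ∀ a b c → a + (b + c) ≡ b + (a + c)
    rotate′ = solve-∀
    swap : ∀ a b → a + (+ 1 + b) ≡ + 1 + (a + b)
    swap = solve-∀
    split : ∀ g → sumOver g (comps (embFo (more f r)))
                  ≡ sumOver g (comps (embFo f)) + sumOver g (strip (embRo r) ∷ compsBr (embRo r))
    split g = trans (cong (_+_ (g (strip (embRo r)))) (sumOver-++ g (comps (embFo f)) (compsBr (embRo r))))
                    (rotate′ (g (strip (embRo r))) (sumOver g (comps (embFo f))) (sumOver g (compsBr (embRo r))))

-- Trees as branches with empty gaps

mutual
  -- Filling all gaps with the empty forest inverts `strip` on branches without decorations, so the
  -- results on the encoding at index `false` carry over to trees.
  undecorated : Tree → Br Forest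
  undecorated (bdry _)    = bdry emptyF
  undecorated (node h cs) = node h (undecoratedL cs)

  undecoratedL : List Tree → List (Br Forest)
  undecoratedL []       = []
  undecoratedL (c ∷ cs) = undecorated c ∷ undecoratedL cs

mutual
  strip-undecorated : ∀ t → strip (undecorated t) ≡ t
  strip-undecorated (bdry _)    = refl
  strip-undecorated (node h cs) = cong (node h) (strip-undecoratedL cs)

  strip-undecoratedL : ∀ cs → stripL (undecoratedL cs) ≡ cs
  strip-undecoratedL []       = refl
  strip-undecoratedL (c ∷ cs) = cong₂ _∷_ (strip-undecorated c) (strip-undecoratedL cs)

mutual
  comps-undecorated : ∀ t → compsBr (undecorated t) ≡ []
  comps-undecorated (bdry _)    = refl
  comps-undecorated (node h cs) = comps-undecoratedL cs

  comps-undecoratedL : ∀ cs → compsL (undecoratedL cs) ≡ []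
  comps-undecoratedL []       = refl
  comps-undecoratedL (c ∷ cs) = cong₂ _++_ (comps-undecorated c) (comps-undecoratedL cs)

mutual
  undecorated-strip : ∀ t → compsBr t ≡ [] → undecorated (strip t) ≡ t
  undecorated-strip (bdry emptyF) _ = refl
  undecorated-strip (node h cs)   e = cong (node h) (undecorated-stripL cs e)

  undecorated-stripL : ∀ cs → compsL cs ≡ [] → undecoratedL (stripL cs) ≡ cs
  undecorated-stripL []       _ = refl
  undecorated-stripL (c ∷ cs) e = cong₂ _∷_ (undecorated-strip c (++-conicalˡ (compsBr c) (compsL cs) e))
                                            (undecorated-stripL cs (++-conicalʳ (compsBr c) (compsL cs) e))

embTree : Class.Obj TreeC → Tree
embTree (_ , r) = strip (embRo r)

no-comps : (r : Ro false) → compsBr (embRo r) ≡ []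
no-comps r = proj₂ (proj₂ (goodRo r)) refl

embTree-injective : ∀ {x y} → embTree x ≡ embTree y → x ≡ y
embTree-injective {_ , r} {_ , s} e = cong (tt ,_) (embRo-injective
  (trans (sym (undecorated-strip (embRo r) (no-comps r)))
    (trans (cong undecorated e) (undecorated-strip (embRo s) (no-comps s)))))

embTree-surjective : ∀ t → isContractedPlabicTree t ≡ true → Preimage embTree t
embTree-surjective t e =
  let r , p = surjRo {false} (undecorated t) (trans (cong isContractedPlabicTree (strip-undecorated t)) e)
                (cong (allB isContractedPlabicTree) (comps-undecorated t) , λ _ → comps-undecorated t)
  in (tt , r) , trans (cong strip p) (strip-undecorated t)

Stats : ℤ → ℤ → ℤ → Weight → Set
Stats n h d (a , k , r) = (n ≡ + a) × (h ≡ + 2 * + k) × (d ≡ + r)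

statsTree : ∀ x → Stats (+ treeN (embTree x)) (hel2Tree (embTree x)) (dimTree (embTree x)) (Class.wt TreeC x)
statsTree (_ , r) with statsRo r
... | p , q , s rewrite no-comps r =
  trans (sym (ℤ.+-identityʳ _)) p , trans (sym (ℤ.+-identityʳ _)) q , trans (sym (ℤ.+-identityʳ _)) s

statsForest : ∀ (f : Fo true) → Stats (+ forestN (embFo f)) (hel2Forest (embFo f)) (dimForest (embFo f)) (wtFo f)
statsForest f with statsFo f
... | p , q , s = trans (sizes (comps (embFo f))) p , trans (helicities (comps (embFo f))) q , s
  where
  sizes : ∀ L → + sumℕ (mapL treeN L) ≡ sumOver treeNℤ L
  sizes []      = refl
  sizes (t ∷ L) = cong (_+_ (+ treeN t)) (sizes L)
  helicities : ∀ L → sumOver hel2v (concatL (mapL verts L)) + + sumℕ (mapL treeN L) ≡ sumOver hel2Tree L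
  helicities []      = refl
  helicities (t ∷ L) = trans
    (cong (_+ + sumℕ (mapL treeN (t ∷ L))) (sumOver-++ hel2v (verts t) (concatL (mapL verts L))))
    (trans (middle-swap (sumOver hel2v (verts t)) _ (+ treeN t) (+ sumℕ (mapL treeN L)))
           (cong (_+_ (hel2Tree t)) (helicities L)))
    where open Identities ℤ.+-*-commutativeSemiring using (middle-swap)

-- From fibres of a class to trees and forests of given type

module _ {A : Class} {T : Set} (enc : Class.Obj A → T) (ok : T → Bool) (size hel dim : T → ℤ)
  (enc-injective : ∀ {x y} → enc x ≡ enc y → x ≡ y)
  (enc-ok : ∀ x → ok (enc x) ≡ true)
  (enc-surjective : ∀ t → ok t ≡ true → Preimage enc t)
  (enc-stats : ∀ x → Stats (size (enc x)) (hel (enc x)) (dim (enc x)) (Class.wt A x))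
  where

  Encoded : ℤ → ℤ → ℤ → T → Set
  Encoded n k r t = (ok t ≡ true) × (size t ≡ n) × (hel t ≡ + 2 * k) × (dim t ≡ r)

  Encoded-≡ : ∀ {n k r} {s t : Σ T (Encoded n k r)} → proj₁ s ≡ proj₁ t → s ≡ t
  Encoded-≡ {s = t , a , b , c , d} {_ , a′ , b′ , c′ , d′} refl = cong (t ,_)
    (cong₂ _,_ (Bool-UIP a a′) (cong₂ _,_ (ℤ-UIP b b′) (cong₂ _,_ (ℤ-UIP c c′) (ℤ-UIP d d′))))
    where
    Bool-UIP : UIP Bool
    Bool-UIP = Decidable⇒UIP.≡-irrelevant Bool._≟_
    ℤ-UIP : UIP ℤ
    ℤ-UIP = Decidable⇒UIP.≡-irrelevant ℤ._≟_

  decode : ∀ n k r {t} → Encoded n k r t → Σ (Class.Obj A) λ x → enc x ≡ t ×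
           let (a , b , c) = Class.wt A x in n ≡ + a × k ≡ + b × r ≡ + c
  decode n k r {t} (o , refl , h , refl) with enc-surjective t o
  ... | x , refl = let p , q , s = enc-stats x in
    x , refl , p , ℤ.*-cancelˡ-≡ (+ 2) k (+ proj₁ (proj₂ (Class.wt A x))) (trans (sym h) q) , s

  Fibre↔Encoded : ∀ a k r → Fibre A (a , k , r) ↔ Σ T (Encoded (+ a) (+ k) (+ r))
  Fibre↔Encoded a k r = section⇒↔ f g (λ (t , e) → Encoded-≡ {+ a} {+ k} {+ r} (proj₁ (proj₂ (decode (+ a) (+ k) (+ r) e))))
    (λ e → Fibre-≡ A (enc-injective (cong proj₁ e)))
    where
    encoded : ∀ x → Class.wt A x ≡ (a , k , r) → Encoded (+ a) (+ k) (+ r) (enc x)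
    encoded x refl = enc-ok x , enc-stats x
    f : Fibre A (a , k , r) → Σ T (Encoded (+ a) (+ k) (+ r))
    f (x , e) = enc x , encoded x e
    g : Σ T (Encoded (+ a) (+ k) (+ r)) → Fibre A (a , k , r)
    g (t , e) = let x , _ , p , q , s = decode (+ a) (+ k) (+ r) e in
      x , sym (cong₂ _,_ (ℤ.+-injective p) (cong₂ _,_ (ℤ.+-injective q) (ℤ.+-injective s)))

  -[1+]≢+ : ∀ {m n} → -[1+ m ] ≢ + n
  -[1+]≢+ ()

  -- `coeff` vanishes at negative exponents. There is no object there either, since `decode`
  -- identifies n, k and r with natural numbers.
  Count-Encoded : ∀ {s} → s counts A → ∀ n k r → Count (Σ T (Encoded n k r)) (coeff s n k r)
  Count-Encoded p (+ a)    (+ k)    (+ r)    = Count-↔ (Fibre↔Encoded a k r) (p a k r)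
  Count-Encoded p n@(-[1+ _ ]) k r = Count-⊥ λ (_ , e) → -[1+]≢+ (proj₁ (proj₂ (proj₂ (decode n k r e))))
  Count-Encoded p n@(+ _) k@(-[1+ _ ]) r = Count-⊥ λ (_ , e) → -[1+]≢+ (proj₁ (proj₂ (proj₂ (proj₂ (decode n k r e)))))
  Count-Encoded p n@(+ _) k@(+ _) r@(-[1+ _ ]) = Count-⊥ λ (_ , e) → -[1+]≢+ (proj₂ (proj₂ (proj₂ (proj₂ (decode n k r e)))))

theorem3p15 : (C Cinv G H Pforest : Series) →
    IsC C →
    IsCompInverse C Cinv →
    G *ₛ (oneₛ +ₛ Ptree Cinv) ≈ₛ Xₛ →
    IsCompInverse G H →
    Xₛ *ₛ Pforest ≈ₛ H →
    ((n k r : ℤ) →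
    (Σ ℕ λ c → (Fin c ↔ Σ Tree (CTree n k r))
    × (+ c ≡ coeff (Ptree Cinv) n k r))
    × (Σ ℕ λ c → (Fin c ↔ Σ Forest (CForest n k r))
    × (+ c ≡ coeff Pforest n k r)))
    × ((n k r : ℕ) →
    + (suc n) * Pforest n k r ≡ powₛ (oneₛ +ₛ Ptree Cinv) (suc n) n k r)
theorem3p15 C Cinv G H Pforest isC inv Gφ GH XP =
  (λ n k r →
    Count-Encoded {TreeC} embTree isContractedPlabicTree (λ t → + treeN t) hel2Tree dimTree
      embTree-injective (λ (_ , r) → proj₁ (goodRo r)) embTree-surjective statsTree
      (Ptree-counts isC inv) n k r ,
    Count-Encoded {FoC true} embFo isContractedPlabicForest (λ f → + forestN f) hel2Forest dimForest
      embFo-injective (λ f → proj₁ (goodFo f)) (λ f e → surjFo f (e , λ ())) statsForest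
      (Pforest-counts isC inv Gφ GH XP) n k r) ,
  lagrangeₛ {oneₛ +ₛ Ptree Cinv} {G} {H} {Pforest} Gφ (proj₁ GH) (proj₂ (proj₂ (proj₂ GH))) XP
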